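{- For every $\varepsilon > 0$ there is $n_0(\varepsilon)$ such that for all $n \ge n_0(\varepsilon)$ and all integers $\ell$ with $3 \le \ell \le (1-\varepsilon)\frac{\log n}{\log\log n}$ we have $$r(C_\ell, K_n) > n\log n \gg (\ell-1)(n-1)+1,$$ where the relation $\gg$ means that the ratio $\frac{(\ell-1)(n-1)+1}{n \log n}$ tends to $0$ as $n\to\infty$, uniformly over $\ell$ in the given range.
   Context: All logarithms are to base $2$. For graphs $G,H$, the Ramsey number $r(G,H)$ is the smallest natural number $N$ such that every red/blue colouring of the edges of the complete graph $K_N$ contains a red copy of $G$ or a blue copy of $H$. $C_\ell$ is the cycle of length $\ell$ and $K_n$ is the complete graph on $n$ vertices. -}

module Defs where

open import Algebra.Bundles using (CommutativeRing)
import Algebra.Definitions.RawSemiring as RawSemiringDefinitions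
import Algebra.Properties.CommutativeSemigroup as CommutativeSemigroupProperties
import Algebra.Properties.Semiring.Exp as SemiringExp
open import Data.Empty using (⊥-elim)
open import Data.Fin.Base using (Fin; zero; suc; toℕ)
import Data.Fin.Properties as Fin
open import Data.Integer.Base as ℤ using (ℤ; +_; -[1+_])
import Data.Integer.Properties as ℤ
open import Data.List.Base using (List; []; _∷_; length; lookup; filter; allFin)
open import Data.List.Membership.Propositional using (_∈_)
open import Data.List.Membership.Propositional.Properties using (∈-filter⁻; ∈-lookup)
import Data.List.Properties as List
open import Data.List.Relation.Unary.All as All using (All; []; _∷_)
open import Data.List.Relation.Unary.AllPairs as AllPairs using (AllPairs; []; _∷_)
open import Data.List.Relation.Unary.Any using (here; there)
open import Data.List.Relation.Unary.Unique.Propositional using (Unique)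
import Data.List.Relation.Unary.Unique.Propositional.Properties as Unique
open import Data.Nat.Base as ℕ using (ℕ; zero; suc; z≤n; s≤s)
import Data.Nat.Properties as ℕ
open import Data.Product using (∃; _×_; _,_; proj₁; proj₂)
open import Data.Rational.Base as ℚ using (ℚ; 0ℚ; 1ℚ; ½)
import Data.Rational.Properties as ℚ
import Data.Rational.Unnormalised.Base as ℚᵘ
import Data.Rational.Unnormalised.Properties as ℚᵘ
open import Data.Sum.Base using (_⊎_; inj₁; inj₂; [_,_]′; swap)
open import Function.Base using (_∘_)
open import Function.Definitions using (Injective)
open import Level using (0ℓ)
open import Relation.Binary.Core using (Rel)
open import Relation.Binary.Definitions using (Decidable; DecidableEquality; Symmetric; tri<; tri≈; tri>)
open import Relation.Binary.PropositionalEquality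
open import Relation.Nullary using (¬_; Dec; yes; no; contradiction)
open import Relation.Nullary.Decidable using (map′; ¬?; _×-dec_; _⊎-dec_; _→-dec_; decidable-stable; toWitness)
import Relation.Unary as U

open RawSemiringDefinitions ℚ.+-*-rawSemiring public
  using (_^_)

-- Dedekind cuts in the textbook form: the real x is given by the set
-- of all rationals q < x, and x ∋ q says that q < x.

record ℝ : Set₁ where
  field
    _∋_       : ℚ → Set
    inhabited : ∃ λ q → _∋_ q
    bounded   : ∃ λ q → ¬ (_∋_ q)
    lower     : ∀ {p q} → p ℚ.< q → _∋_ q → _∋_ p
    open′     : ∀ {p} → _∋_ p → ∃ λ q → p ℚ.< q × _∋_ q

infix 4 _∋_ _<ᴿ_ _≤ᴿ_ _>ᴿ_ _≺_

_∋_ : ℝ → ℚ → Set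
_∋_ = ℝ._∋_

-- x ≺ q says that x < q, for q rational.

_≺_ : ℝ → ℚ → Set
x ≺ q = ∃ λ p → p ℚ.< q × ¬ (x ∋ p)

_≤ᴿ_ _<ᴿ_ _>ᴿ_ : ℝ → ℝ → Set
x ≤ᴿ y = ∀ q → x ∋ q → y ∋ q
x <ᴿ y = ∃ λ q → ¬ (x ∋ q) × y ∋ q
x >ᴿ y = y <ᴿ x

private
  <⇒∋-lt : ∀ (x : ℝ) {p q} → x ∋ p → ¬ (x ∋ q) → p ℚ.< q
  <⇒∋-lt x {p} {q} xp ¬xq with ℚ.<-cmp p q
  ... | tri< p<q _ _ = p<q
  ... | tri≈ _ refl _ = contradiction xp ¬xq
  ... | tri> _ _ q<p = contradiction (ℝ.lower x q<p xp) ¬xq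

  ∋-≺ : ∀ (x : ℝ) {p q} → x ∋ p → x ≺ q → p ℚ.< q
  ∋-≺ x xp (r , r<q , ¬xr) = ℚ.<-trans (<⇒∋-lt x xp ¬xr) r<q

  p-1<p : ∀ p → p ℚ.- 1ℚ ℚ.< p
  p-1<p p = subst (p ℚ.- 1ℚ ℚ.<_) (ℚ.+-identityʳ p)
    (ℚ.+-monoʳ-< p (toWitness {a? = (ℚ.- 1ℚ) ℚ.<? 0ℚ} _))

  p<p+1 : ∀ p → p ℚ.< p ℚ.+ 1ℚ
  p<p+1 p = subst (ℚ._< p ℚ.+ 1ℚ) (ℚ.+-identityʳ p)
    (ℚ.+-monoʳ-< p (toWitness {a? = 0ℚ ℚ.<? 1ℚ} _))

  above : ∀ (x : ℝ) → ∃ λ q → x ≺ q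
  above x = let q , ¬xq = ℝ.bounded x in q ℚ.+ 1ℚ , q , p<p+1 q , ¬xq

ℚ⇒ℝ : ℚ → ℝ
ℚ⇒ℝ p = record
  { _∋_       = ℚ._< p
  ; inhabited = p ℚ.- 1ℚ , p-1<p p
  ; bounded   = p , ℚ.<-irrefl refl
  ; lower     = ℚ.<-trans
  ; open′     = λ q<p → let r , q<r , r<p = ℚ.<-dense q<p in r , q<r , r<p
  }

ℕ⇒ℚ : ℕ → ℚ
ℕ⇒ℚ n = + n ℚ./ 1

ℕ⇒ℝ : ℕ → ℝ
ℕ⇒ℝ n = ℚ⇒ℝ (ℕ⇒ℚ n)

0ᴿ 1ᴿ : ℝ
0ᴿ = ℚ⇒ℝ 0ℚ
1ᴿ = ℚ⇒ℝ 1ℚ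

-- A cut presented as the rationals lying strictly below some element of
-- a nonempty set of rationals that is bounded above: its supremum.

sup : (S : ℚ → Set) → ∃ S → (∃ λ m → ∀ s → S s → s ℚ.≤ m) → ℝ
sup S (s₀ , Ss₀) (m , S≤m) = record
  { _∋_       = λ q → ∃ λ s → S s × q ℚ.< s
  ; inhabited = s₀ ℚ.- 1ℚ , s₀ , Ss₀ , p-1<p s₀
  ; bounded   = m , λ { (s , Ss , m<s) →
                  ℚ.<-irrefl refl (ℚ.<-≤-trans m<s (S≤m s Ss)) }
  ; lower     = λ { p<q (s , Ss , q<s) → s , Ss , ℚ.<-trans p<q q<s }
  ; open′     = λ { (s , Ss , q<s) →
                  let r , q<r , r<s = ℚ.<-dense q<s in r , q<r , s , Ss , r<s }
  }

infixl 6 _-ᴿ_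
infixl 7 _*ᴿ_

_-ᴿ_ : ℝ → ℝ → ℝ
x -ᴿ y = sup S nonempty bound
  where
  S : ℚ → Set
  S s = ∃ λ a → ∃ λ b → x ∋ a × y ≺ b × s ≡ a ℚ.- b

  nonempty : ∃ S
  nonempty =
    let a , xa = ℝ.inhabited x
        b , yb = above y
    in a ℚ.- b , a , b , xa , yb , refl

  bound : ∃ λ m → ∀ s → S s → s ℚ.≤ m
  bound =
    let A , xA = above x
        B , yB = ℝ.inhabited y
    in A ℚ.- B , λ { _ (a , b , xa , yb , refl) →
         ℚ.<⇒≤ (ℚ.+-mono-< (∋-≺ x xa xA) (ℚ.neg-antimono-< (∋-≺ y yB yb))) }

-- If a < x < a′ and b < y < b′, then xy is at least the least of the
-- four products of endpoints; no signs need to be known.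

corner : (a a′ b b′ : ℚ) → ℚ
corner a a′ b b′ = ((a ℚ.* b) ℚ.⊓ (a ℚ.* b′)) ℚ.⊓ ((a′ ℚ.* b) ℚ.⊓ (a′ ℚ.* b′))

private
  *-monoˡ : ∀ {t p q} → 0ℚ ℚ.≤ t → p ℚ.≤ q → p ℚ.* t ℚ.≤ q ℚ.* t
  *-monoˡ {t} 0≤t = ℚ.*-monoʳ-≤-nonNeg t {{ℚ.nonNegative 0≤t}}

  *-antiˡ : ∀ {t p q} → t ℚ.≤ 0ℚ → p ℚ.≤ q → q ℚ.* t ℚ.≤ p ℚ.* t
  *-antiˡ {t} t≤0 = ℚ.*-monoʳ-≤-nonPos t {{ℚ.nonPositive t≤0}}

  min≤ : ∀ {a a′ s} t → a ℚ.≤ s → s ℚ.≤ a′ → (a ℚ.* t) ℚ.⊓ (a′ ℚ.* t) ℚ.≤ s ℚ.* t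
  min≤ {a} {a′} t a≤s s≤a′ with ℚ.≤-total 0ℚ t
  ... | inj₁ 0≤t = ℚ.≤-trans (ℚ.p⊓q≤p (a ℚ.* t) (a′ ℚ.* t)) (*-monoˡ 0≤t a≤s)
  ... | inj₂ t≤0 = ℚ.≤-trans (ℚ.p⊓q≤q (a ℚ.* t) (a′ ℚ.* t)) (*-antiˡ t≤0 s≤a′)

  ≤max : ∀ {a a′ s} t → a ℚ.≤ s → s ℚ.≤ a′ → s ℚ.* t ℚ.≤ (a ℚ.* t) ℚ.⊔ (a′ ℚ.* t)
  ≤max {a} {a′} t a≤s s≤a′ with ℚ.≤-total 0ℚ t
  ... | inj₁ 0≤t = ℚ.≤-trans (*-monoˡ 0≤t s≤a′) (ℚ.p≤q⊔p (a ℚ.* t) (a′ ℚ.* t))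
  ... | inj₂ t≤0 = ℚ.≤-trans (*-antiˡ t≤0 a≤s) (ℚ.p≤p⊔q (a ℚ.* t) (a′ ℚ.* t))

  min≤′ : ∀ {b b′ t} s → b ℚ.≤ t → t ℚ.≤ b′ → (s ℚ.* b) ℚ.⊓ (s ℚ.* b′) ℚ.≤ s ℚ.* t
  min≤′ {b} {b′} {t} s b≤t t≤b′
    rewrite ℚ.*-comm s b | ℚ.*-comm s b′ | ℚ.*-comm s t = min≤ s b≤t t≤b′

  ≤max′ : ∀ {b b′ t} s → b ℚ.≤ t → t ℚ.≤ b′ → s ℚ.* t ℚ.≤ (s ℚ.* b) ℚ.⊔ (s ℚ.* b′)
  ≤max′ {b} {b′} {t} s b≤t t≤b′
    rewrite ℚ.*-comm s b | ℚ.*-comm s b′ | ℚ.*-comm s t = ≤max s b≤t t≤b′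

  corner≤ : ∀ {a a′ b b′ s t} → a ℚ.≤ s → s ℚ.≤ a′ → b ℚ.≤ t → t ℚ.≤ b′ →
            corner a a′ b b′ ℚ.≤ s ℚ.* t
  corner≤ {a} {a′} {t = t} a≤s s≤a′ b≤t t≤b′ =
    ℚ.≤-trans (ℚ.⊓-mono-≤ (min≤′ a b≤t t≤b′) (min≤′ a′ b≤t t≤b′)) (min≤ t a≤s s≤a′)

_*ᴿ_ : ℝ → ℝ → ℝ
x *ᴿ y = sup S nonempty bound
  where
  S : ℚ → Set
  S s = ∃ λ a → ∃ λ a′ → ∃ λ b → ∃ λ b′ →
        (x ∋ a × x ≺ a′) × (y ∋ b × y ≺ b′) × s ≡ corner a a′ b b′

  nonempty : ∃ S
  nonempty =
    let a  , xa  = ℝ.inhabited x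
        a′ , xa′ = above x
        b  , yb  = ℝ.inhabited y
        b′ , yb′ = above y
    in corner a a′ b b′ , a , a′ , b , b′ , (xa , xa′) , (yb , yb′) , refl

  bound : ∃ λ m → ∀ s → S s → s ℚ.≤ m
  bound =
    let A  , xA  = ℝ.inhabited x
        A′ , xA′ = above x
        B  , yB  = ℝ.inhabited y
        B′ , yB′ = above y
    in ((A ℚ.* B) ℚ.⊔ (A ℚ.* B′)) ℚ.⊔ ((A′ ℚ.* B) ℚ.⊔ (A′ ℚ.* B′)) ,
       λ { _ (a , a′ , b , b′ , (xa , xa′) , (yb , yb′) , refl) →
         let s = a ℚ.⊔ A
             t = b ℚ.⊔ B
             s≤a′ = ℚ.⊔-lub (ℚ.<⇒≤ (∋-≺ x xa xa′)) (ℚ.<⇒≤ (∋-≺ x xA xa′))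
             s≤A′ = ℚ.⊔-lub (ℚ.<⇒≤ (∋-≺ x xa xA′)) (ℚ.<⇒≤ (∋-≺ x xA xA′))
             t≤b′ = ℚ.⊔-lub (ℚ.<⇒≤ (∋-≺ y yb yb′)) (ℚ.<⇒≤ (∋-≺ y yB yb′))
             t≤B′ = ℚ.⊔-lub (ℚ.<⇒≤ (∋-≺ y yb yB′)) (ℚ.<⇒≤ (∋-≺ y yB yB′))
         in ℚ.≤-trans (corner≤ (ℚ.p≤p⊔q a A) s≤a′ (ℚ.p≤p⊔q b B) t≤b′)
           (ℚ.≤-trans (≤max t (ℚ.p≤q⊔p a A) s≤A′)
             (ℚ.⊔-mono-≤ (≤max′ A (ℚ.p≤q⊔p b B) t≤B′) (≤max′ A′ (ℚ.p≤q⊔p b B) t≤B′))) }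

private
  positive-element : ∀ (x : ℝ) → 0ᴿ <ᴿ x → ∃ λ q → 0ℚ ℚ.< q × x ∋ q
  positive-element x (p , 0≤p , xp) =
    let q , p<q , xq = ℝ.open′ x xp in q , ℚ.≤-<-trans (ℚ.≮⇒≥ 0≤p) p<q , xq

  *-pos : ∀ {p q} → 0ℚ ℚ.< p → 0ℚ ℚ.< q → 0ℚ ℚ.< p ℚ.* q
  *-pos {p} {q} 0<p 0<q = subst (ℚ._< p ℚ.* q) (ℚ.*-zeroˡ q)
    (ℚ.*-monoˡ-<-pos q {{ℚ.positive 0<q}} 0<p)

  <⊓ : ∀ {p q r} → p ℚ.< q → p ℚ.< r → p ℚ.< q ℚ.⊓ r
  <⊓ {p} {q} {r} p<q p<r with ℚ.⊓-sel q r
  ... | inj₁ e = subst (p ℚ.<_) (sym e) p<q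
  ... | inj₂ e = subst (p ℚ.<_) (sym e) p<r

*ᴿ-pos : ∀ {x y} → 0ᴿ <ᴿ x → 0ᴿ <ᴿ y → 0ᴿ <ᴿ x *ᴿ y
*ᴿ-pos {x} {y} 0<x 0<y =
  let a  , 0<a , xa = positive-element x 0<x
      a′ , xa′      = above x
      b  , 0<b , yb = positive-element y 0<y
      b′ , yb′      = above y
      0<a′ = ℚ.<-trans 0<a (∋-≺ x xa xa′)
      0<b′ = ℚ.<-trans 0<b (∋-≺ y yb yb′)
  in 0ℚ , ℚ.<-irrefl refl , corner a a′ b b′ ,
     (a , a′ , b , b′ , (xa , xa′) , (yb , yb′) , refl) ,
     <⊓ (<⊓ (*-pos 0<a 0<b) (*-pos 0<a 0<b′)) (<⊓ (*-pos 0<a′ 0<b) (*-pos 0<a′ 0<b′))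

-- The reciprocal of y > 0 is the supremum of the s with s b = 1 for
-- some rational b > y.

recip : (y : ℝ) → 0ᴿ <ᴿ y → ℝ
recip y 0<y = sup S nonempty bound
  where
  S : ℚ → Set
  S s = ∃ λ b → y ≺ b × s ℚ.* b ≡ 1ℚ

  B = proj₁ (positive-element y 0<y)
  0<B = proj₁ (proj₂ (positive-element y 0<y))
  yB = proj₂ (proj₂ (positive-element y 0<y))

  positive : ∀ {b} → y ≺ b → ℚ.Positive b
  positive yb = ℚ.positive (ℚ.<-trans 0<B (∋-≺ y yB yb))

  nonempty : ∃ S
  nonempty =
    let b , yb = above y
        instance b≢0 = ℚ.pos⇒nonZero b {{positive yb}}
    in ℚ.1/ b , b , yb , ℚ.*-inverseˡ b

  bound : ∃ λ m → ∀ s → S s → s ℚ.≤ m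
  bound = 1/B , below
    where
    instance
      B>0 = ℚ.positive 0<B
      B≢0 = ℚ.pos⇒nonZero B
    1/B = ℚ.1/ B
    below : ∀ s → S s → s ℚ.≤ 1/B
    below s (b , yb , sb≡1) = ℚ.*-cancelʳ-≤-pos b {{positive yb}}
      (subst₂ ℚ._≤_ (trans (ℚ.*-inverseˡ B) (sym sb≡1)) refl
        (ℚ.*-monoˡ-≤-nonNeg 1/B {{ℚ.pos⇒nonNeg 1/B {{ℚ.1/pos⇒pos B}}}}
          (ℚ.<⇒≤ (∋-≺ y yB yb))))

_/ᴿ_[_] : (x y : ℝ) → 0ᴿ <ᴿ y → ℝ
x /ᴿ y [ 0<y ] = x *ᴿ recip y 0<y

2^_ : ℤ → ℚ
2^ (+ n)    = ℕ⇒ℚ 2 ^ n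
2^ -[1+ n ] = ½ ^ suc n

private
  open CommutativeSemigroupProperties (CommutativeRing.*-commutativeSemigroup ℚ.+-*-commutativeRing)
    using (interchange)
  module Exp = SemiringExp (CommutativeRing.semiring ℚ.+-*-commutativeRing)

  ^-nonNeg : ∀ {p} n → 0ℚ ℚ.≤ p → 0ℚ ℚ.≤ p ^ n
  ^-nonNeg zero    0≤p = toWitness {a? = 0ℚ ℚ.≤? 1ℚ} _
  ^-nonNeg {p} (suc n) 0≤p =
    subst (ℚ._≤ p ℚ.* p ^ n) (ℚ.*-zeroˡ (p ^ n)) (*-monoˡ (^-nonNeg n 0≤p) 0≤p)

  ^-mono : ∀ {p q} n → 0ℚ ℚ.≤ p → p ℚ.≤ q → p ^ n ℚ.≤ q ^ n
  ^-mono zero    0≤p p≤q = ℚ.≤-refl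
  ^-mono {p} {q} (suc n) 0≤p p≤q =
    ℚ.≤-trans (*-monoˡ (^-nonNeg n 0≤p) p≤q)
      (ℚ.*-monoˡ-≤-nonNeg q {{ℚ.nonNegative (ℚ.≤-trans 0≤p p≤q)}} (^-mono n 0≤p p≤q))

  1≤2^ : ∀ n → 1ℚ ℚ.≤ ℕ⇒ℚ 2 ^ n
  1≤2^ zero    = ℚ.≤-refl
  1≤2^ (suc n) = ℚ.≤-trans (toWitness {a? = 1ℚ ℚ.≤? ℕ⇒ℚ 2 ℚ.* 1ℚ} _)
    (ℚ.*-monoˡ-≤-nonNeg (ℕ⇒ℚ 2) {{_}} (1≤2^ n))

  2^-mono : ∀ {m n} → m ℕ.≤ n → ℕ⇒ℚ 2 ^ m ℚ.≤ ℕ⇒ℚ 2 ^ n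
  2^-mono {m} {n} z≤n = 1≤2^ n
  2^-mono (s≤s m≤n) = ℚ.*-monoˡ-≤-nonNeg (ℕ⇒ℚ 2) {{_}} (2^-mono m≤n)

  /-mono-≤ : ∀ {a b c d} → a ℤ.* + suc d ℤ.≤ c ℤ.* + suc b → a ℚ./ suc b ℚ.≤ c ℚ./ suc d
  /-mono-≤ {a} {b} {c} {d} h = ℚ.toℚᵘ-cancel-≤
    (ℚᵘ.≤-respˡ-≃ (ℚᵘ.≃-sym (ℚ.toℚᵘ-fromℚᵘ (ℚᵘ.mkℚᵘ a b)))
      (ℚᵘ.≤-respʳ-≃ (ℚᵘ.≃-sym (ℚ.toℚᵘ-fromℚᵘ (ℚᵘ.mkℚᵘ c d))) (ℚᵘ.*≤* h)))

  ℕ⇒ℚ-suc : ∀ n → ℕ⇒ℚ (suc n) ≡ 1ℚ ℚ.+ ℕ⇒ℚ n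
  ℕ⇒ℚ-suc n = ℚ.toℚᵘ-injective (ℚᵘ.≃-trans (ℚ.toℚᵘ-fromℚᵘ (ℚᵘ.mkℚᵘ (+ suc n) 0))
    (ℚᵘ.≃-sym (ℚᵘ.≃-trans (ℚ.toℚᵘ-homo-+ 1ℚ (ℕ⇒ℚ n))
      (ℚᵘ.≃-trans (ℚᵘ.+-congʳ (ℚ.toℚᵘ 1ℚ) (ℚ.toℚᵘ-fromℚᵘ (ℚᵘ.mkℚᵘ (+ n) 0)))
        (ℚᵘ.*≡* (cong (ℤ._* + 1) (cong (λ z → + 1 ℤ.+ z) (ℤ.*-identityʳ (+ n)))))))))

  ℕ⇒ℚ-mono : ∀ {m n} → m ℕ.≤ n → ℕ⇒ℚ m ℚ.≤ ℕ⇒ℚ n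
  ℕ⇒ℚ-mono {m} {n} m≤n = /-mono-≤ {+ m} {0} {+ n} {0} (ℤ.*-monoʳ-≤-nonNeg (+ 1) (ℤ.+≤+ m≤n))

  ℕ≤2^ : ∀ n → ℕ⇒ℚ n ℚ.≤ ℕ⇒ℚ 2 ^ n
  ℕ≤2^ zero    = toWitness {a? = 0ℚ ℚ.≤? 1ℚ} _
  ℕ≤2^ (suc n) = subst₂ ℚ._≤_ (sym (ℕ⇒ℚ-suc n)) double (ℚ.+-mono-≤ (1≤2^ n) (ℕ≤2^ n))
    where
    t = ℕ⇒ℚ 2 ^ n
    double : t ℚ.+ t ≡ ℕ⇒ℚ 2 ℚ.* t
    double = sym (trans (ℚ.*-distribʳ-+ t 1ℚ 1ℚ)
      (cong₂ ℚ._+_ (ℚ.*-identityˡ t) (ℚ.*-identityˡ t)))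

  ceiling : ℚ → ℕ
  ceiling q = ℤ.∣ ℚ.↥ q ∣

  ≤ceiling : ∀ q → q ℚ.≤ ℕ⇒ℚ (ceiling q)
  ≤ceiling q = subst (ℚ._≤ ℕ⇒ℚ (ceiling q)) (ℚ.↥p/↧p≡p q)
    (/-mono-≤ {ℚ.↥ q} {ℚ.denominator-1 q} {+ ceiling q} (ℤ.≤-trans
      (ℤ.≤-reflexive (ℤ.*-identityʳ (ℚ.↥ q)))
      (ℤ.≤-trans (i≤∣i∣ (ℚ.↥ q))
        (ℤ.≤-trans (ℤ.+≤+ (ℕ.m≤m*n (ceiling q) (suc (ℚ.denominator-1 q))))
          (ℤ.≤-reflexive (ℤ.pos-* (ceiling q) _))))))
    where
    i≤∣i∣ : ∀ i → i ℤ.≤ + ℤ.∣ i ∣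
    i≤∣i∣ (+ n)    = ℤ.≤-refl
    i≤∣i∣ -[1+ n ] = ℤ.-≤+

  ½^*2^ : ∀ n → ½ ^ n ℚ.* ℕ⇒ℚ 2 ^ n ≡ 1ℚ
  ½^*2^ zero    = refl
  ½^*2^ (suc n) = trans (interchange ½ (½ ^ n) (ℕ⇒ℚ 2) (ℕ⇒ℚ 2 ^ n))
    (trans (ℚ.*-identityˡ _) (½^*2^ n))

-- log₂ x is the supremum of the rationals a/b with 2^(a/b) < x, that is,
-- with 2^a < r^b for some rational 0 < r < x.

log₂ : (x : ℝ) → 0ᴿ <ᴿ x → ℝ
log₂ x 0<x = sup S nonempty bound
  where
  S : ℚ → Set
  S s = ∃ λ (a : ℤ) → ∃ λ (b-1 : ℕ) → ∃ λ r →
        x ∋ r × 0ℚ ℚ.< r × (2^ a) ℚ.< r ^ suc b-1 × s ≡ a ℚ./ suc b-1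

  nonempty : ∃ S
  nonempty =
    let r , 0<r , xr = positive-element x 0<x
        instance r>0 = ℚ.positive 0<r
                 r≢0 = ℚ.pos⇒nonZero r
        k = ceiling (ℚ.1/ r)
        1/r<2^ : ℚ.1/ r ℚ.< ℕ⇒ℚ 2 ^ suc k
        1/r<2^ = ℚ.≤-<-trans (≤ceiling (ℚ.1/ r))
          (ℚ.<-≤-trans (subst (ℕ⇒ℚ k ℚ.<_) (trans (ℚ.+-comm (ℕ⇒ℚ k) 1ℚ) (sym (ℕ⇒ℚ-suc k))) (p<p+1 (ℕ⇒ℚ k)))
            (ℕ≤2^ (suc k)))
        2^>0 = ℚ.pos⇒nonNeg (ℕ⇒ℚ 2 ^ suc k) {{ℚ.positive (ℚ.<-≤-trans (toWitness {a? = 0ℚ ℚ.<? 1ℚ} _) (1≤2^ (suc k)))}}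
        ½^<r : ½ ^ suc k ℚ.< r ^ 1
        ½^<r = subst (½ ^ suc k ℚ.<_) (sym (ℚ.*-identityʳ r))
          (ℚ.*-cancelʳ-<-nonNeg (ℕ⇒ℚ 2 ^ suc k) {{2^>0}}
            (subst (ℚ._< r ℚ.* ℕ⇒ℚ 2 ^ suc k) (trans (ℚ.*-inverseʳ r) (sym (½^*2^ (suc k))))
              (ℚ.*-monoʳ-<-pos r 1/r<2^)))
    in -[1+ k ] ℚ./ 1 , -[1+ k ] , 0 , r , xr , 0<r , ½^<r , refl

  bound : ∃ λ m → ∀ s → S s → s ℚ.≤ m
  bound = ℕ⇒ℚ k , below
    where
    Q = proj₁ (above x)
    xQ = proj₂ (above x)
    k = ceiling Q
    below : ∀ s → S s → s ℚ.≤ ℕ⇒ℚ k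
    below _ (-[1+ n ] , b , r , xr , 0<r , h , refl) =
      ℚ.≤-trans (/-mono-≤ { -[1+ n ]} {b} {+ 0} {0} ℤ.-≤+) (ℕ⇒ℚ-mono {0} {k} z≤n)
    below _ (+ n , b , r , xr , 0<r , h , refl) with n ℕ.≤? k ℕ.* suc b
    ... | yes n≤kb = /-mono-≤ {+ n} {b} {+ k} {0} (subst₂ ℤ._≤_
            (sym (ℤ.*-identityʳ (+ n))) (ℤ.pos-* k (suc b)) (ℤ.+≤+ n≤kb))
    ... | no n≰kb = ⊥-elim (ℚ.<-irrefl refl (ℚ.<-≤-trans h (ℚ.≤-trans
            (^-mono (suc b) (ℚ.<⇒≤ 0<r)
              (ℚ.≤-trans (ℚ.<⇒≤ (∋-≺ x xr xQ)) (ℚ.≤-trans (≤ceiling Q) (ℕ≤2^ k))))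
            (ℚ.≤-trans (ℚ.≤-reflexive (Exp.^-assocʳ (ℕ⇒ℚ 2) k (suc b)))
              (2^-mono (ℕ.<⇒≤ (ℕ.≰⇒> n≰kb)))))))

-- The bound n ≥ 3 makes log₂ (log₂ n) positive, so that it may be
-- divided by.

private
  29/10 : ℚ
  29/10 = + 29 ℚ./ 10

  29/10< : ∀ {n} → 3 ℕ.≤ n → ℕ⇒ℝ n ∋ 29/10
  29/10< {n} 3≤n = ℚ.<-≤-trans (toWitness {a? = 29/10 ℚ.<? ℕ⇒ℚ 3} _) (ℕ⇒ℚ-mono {3} {n} 3≤n)

ℕ⇒ℝ-pos : ∀ {n} → 3 ℕ.≤ n → 0ᴿ <ᴿ ℕ⇒ℝ n
ℕ⇒ℝ-pos {n} 3≤n = 0ℚ , ℚ.<-irrefl refl ,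
  ℚ.<-≤-trans (toWitness {a? = 0ℚ ℚ.<? ℕ⇒ℚ 3} _) (ℕ⇒ℚ-mono {3} {n} 3≤n)

log : (n : ℕ) → 3 ℕ.≤ n → ℝ
log n 3≤n = log₂ (ℕ⇒ℝ n) (ℕ⇒ℝ-pos 3≤n)

private
  log∋ : ∀ {n} (3≤n : 3 ℕ.≤ n) {q} → q ℚ.< + 3 ℚ./ 2 → log n 3≤n ∋ q
  log∋ 3≤n q<3/2 = + 3 ℚ./ 2 ,
    (+ 3 , 1 , 29/10 , 29/10< 3≤n , toWitness {a? = 0ℚ ℚ.<? 29/10} _ ,
      toWitness {a? = (2^ (+ 3)) ℚ.<? 29/10 ^ 2} _ , refl) , q<3/2

log-pos : ∀ {n} (3≤n : 3 ℕ.≤ n) → 0ᴿ <ᴿ log n 3≤n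
log-pos 3≤n = 0ℚ , ℚ.<-irrefl refl , log∋ 3≤n (toWitness {a? = 0ℚ ℚ.<? + 3 ℚ./ 2} _)

loglog : (n : ℕ) → 3 ℕ.≤ n → ℝ
loglog n 3≤n = log₂ (log n 3≤n) (log-pos 3≤n)

loglog-pos : ∀ {n} (3≤n : 3 ℕ.≤ n) → 0ᴿ <ᴿ loglog n 3≤n
loglog-pos 3≤n = 0ℚ , ℚ.<-irrefl refl , + 1 ℚ./ 4 ,
  (+ 1 , 3 , 6/5 , log∋ 3≤n (toWitness {a? = 6/5 ℚ.<? + 3 ℚ./ 2} _) ,
    toWitness {a? = 0ℚ ℚ.<? 6/5} _ , toWitness {a? = (2^ (+ 1)) ℚ.<? 6/5 ^ 4} _ , refl) ,
  toWitness {a? = 0ℚ ℚ.<? + 1 ℚ./ 4} _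
  where
  6/5 = + 6 ℚ./ 5

nlogn : (n : ℕ) → 3 ℕ.≤ n → ℝ
nlogn n 3≤n = ℕ⇒ℝ n *ᴿ log n 3≤n

nlogn-pos : ∀ {n} (3≤n : 3 ℕ.≤ n) → 0ᴿ <ᴿ nlogn n 3≤n
nlogn-pos {n} 3≤n = *ᴿ-pos {ℕ⇒ℝ n} {log n 3≤n} (ℕ⇒ℝ-pos 3≤n) (log-pos 3≤n)

record Graph : Set₁ where
  field
    order  : ℕ
    _~_    : Rel (Fin order) 0ℓ
    _~?_   : Decidable _~_
    ~-sym  : Symmetric _~_
    irrefl : ∀ {i} → ¬ (i ~ i)

complete : ℕ → Graph
complete n = record
  { order  = n
  ; _~_    = _≢_
  ; _~?_   = λ i j → ¬? (i Fin.≟ j)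
  ; ~-sym  = ≢-sym
  ; irrefl = λ i≢i → i≢i refl
  }

-- j follows i on the cycle 0, 1, …, ℓ-1, 0.

Next : ∀ {ℓ} → Rel (Fin ℓ) 0ℓ
Next {ℓ} i j = suc (toℕ i) ≡ toℕ j ⊎ suc (toℕ i) ≡ ℓ × toℕ j ≡ 0

cycle : (ℓ : ℕ) → 3 ℕ.≤ ℓ → Graph
cycle ℓ 3≤ℓ = record
  { order  = ℓ
  ; _~_    = λ i j → Next i j ⊎ Next j i
  ; _~?_   = λ i j → next? i j ⊎-dec next? j i
  ; ~-sym  = swap
  ; irrefl = [ loopless , loopless ]′
  }
  where
  next? : Decidable (Next {ℓ})
  next? i j = (suc (toℕ i) ℕ.≟ toℕ j) ⊎-dec ((suc (toℕ i) ℕ.≟ ℓ) ×-dec (toℕ j ℕ.≟ 0))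

  loopless : ∀ {i : Fin ℓ} → ¬ Next i i
  loopless (inj₁ e) = ℕ.1+n≢n e
  loopless (inj₂ (e , i≡0)) =
    contradiction (ℕ.≤-trans 3≤ℓ (ℕ.≤-reflexive (trans (sym e) (cong suc i≡0)))) λ { (s≤s ()) }

data Colour : Set where
  red blue : Colour

-- Only the colours of pairs of distinct vertices matter: a copy of a
-- graph never uses the diagonal.

record Colouring (N : ℕ) : Set where
  field
    colour     : Fin N → Fin N → Colour
    colour-sym : ∀ i j → colour i j ≡ colour j i

-- A copy of G, not necessarily induced, in the graph on Fin N whose
-- adjacency relation is E.

Copy : Graph → ∀ {N} → Rel (Fin N) 0ℓ → Set
Copy G {N} E = ∃ λ (f : Fin order → Fin N) →
  Injective _≡_ _≡_ f × (∀ i j → i ~ j → E (f i) (f j))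
  where open Graph G

Arrows : ℕ → Graph → Graph → Set
Arrows N G H = (c : Colouring N) → let open Colouring c in
  Copy G (λ i j → colour i j ≡ red) ⊎ Copy H (λ i j → colour i j ≡ blue)

IsRamseyNumber : Graph → Graph → ℕ → Set
IsRamseyNumber G H N = Arrows N G H × (∀ M → Arrows M G H → N ℕ.≤ M)

-- Ramsey numbers exist: Arrows N G H is decidable by exhaustive search,
-- and holds for some N by the neighbourhood-splitting argument below.

private
  Searchable : ∀ {A : Set} → Rel A 0ℓ → Set₁
  Searchable {A} _≈_ = (P : A → Set) → (∀ {a b} → a ≈ b → P a → P b) → U.Decidable P → Dec (∃ P)

  search-Colour : Searchable {Colour} _≡_
  search-Colour P respects P? = map′
    [ red ,_ , blue ,_ ]′
    (λ { (red , p) → inj₁ p ; (blue , p) → inj₂ p })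
    (P? red ⊎-dec P? blue)

  search-Fin : ∀ {n} → Searchable {Fin n} _≡_
  search-Fin P respects P? = Fin.any? P?

  Pointwise : ∀ {A : Set} → Rel A 0ℓ → ∀ {n} → Rel (Fin n → A) 0ℓ
  Pointwise _≈_ f g = ∀ i → f i ≈ g i

  cons : ∀ {A : Set} {n} → A → (Fin n → A) → Fin (suc n) → A
  cons a f zero    = a
  cons a f (suc i) = f i

  search-→ : ∀ {A : Set} {_≈_ : Rel A 0ℓ} → (∀ {a} → a ≈ a) →
             Searchable _≈_ → ∀ n → Searchable (Pointwise _≈_ {n})
  search-→ rfl search zero P respects P? = map′ (_ ,_) (λ { (f , p) → respects (λ ()) p }) (P? (λ ()))
  search-→ {_≈_ = _≈_} rfl search (suc n) P respects P? = map′
    (λ { (a , f , p) → cons a f , p })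
    (λ { (f , p) → f zero , f ∘ suc , respects (λ { zero → rfl ; (suc i) → rfl }) p })
    (search _ (λ { a≈b (f , p) → f , respects (λ { zero → a≈b ; (suc i) → rfl }) p })
      (λ a → search-→ rfl search n _ (λ f≈g → respects (λ { zero → rfl ; (suc i) → f≈g i }))
        (λ f → P? (cons a f))))

  _≟ᶜ_ : DecidableEquality Colour
  red  ≟ᶜ red  = yes refl
  red  ≟ᶜ blue = no λ ()
  blue ≟ᶜ red  = no λ ()
  blue ≟ᶜ blue = yes refl

  copy? : ∀ G {N} {E : Rel (Fin N) 0ℓ} → Decidable E → Dec (Copy G E)
  copy? G {N} {E} E? = search-→ refl search-Fin order _ respects λ f →
    map′ (λ h {i} {j} → h i j) (λ h i j → h {i} {j})
      (Fin.all? λ i → Fin.all? λ j → (f i Fin.≟ f j) →-dec (i Fin.≟ j))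
    ×-dec (Fin.all? λ i → Fin.all? λ j → (i ~? j) →-dec E? (f i) (f j))
    where
    open Graph G
    respects : ∀ {f g : Fin order → Fin N} → (∀ i → f i ≡ g i) →
           Injective _≡_ _≡_ f × (∀ i j → i ~ j → E (f i) (f j)) →
           Injective _≡_ _≡_ g × (∀ i j → i ~ j → E (g i) (g j))
    respects f≗g (inj , hom) =
      (λ {i} {j} e → inj (trans (f≗g i) (trans e (sym (f≗g j))))) ,
      (λ i j i~j → subst₂ E (f≗g i) (f≗g j) (hom i j i~j))

  copy-mono : ∀ G {N} {E F : Rel (Fin N) 0ℓ} → (∀ i j → E i j → F i j) → Copy G E → Copy G F
  copy-mono G E⊆F (f , inj , hom) = f , inj , λ i j i~j → E⊆F _ _ (hom i j i~j)

  arrows? : ∀ N G H → Dec (Arrows N G H)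
  arrows? N G H = map′
    (λ none c → let open Colouring c in
      decidable-stable (good? colour) (λ bad → none (colour , colour-sym , bad)))
    (λ arrows → λ { (m , m-sym , bad) → bad (arrows record { colour = m ; colour-sym = m-sym }) })
    (¬? (search-→ (λ _ → refl) (search-→ refl search-Colour N) N Bad respects
      (λ m → (Fin.all? λ i → Fin.all? λ j → m i j ≟ᶜ m j i) ×-dec ¬? (good? m))))
    where
    Good Bad : (Fin N → Fin N → Colour) → Set
    Good m = Copy G (λ i j → m i j ≡ red) ⊎ Copy H (λ i j → m i j ≡ blue)
    Bad m = (∀ i j → m i j ≡ m j i) × ¬ Good m

    good? : U.Decidable Good
    good? m = copy? G (λ i j → m i j ≟ᶜ red) ⊎-dec copy? H (λ i j → m i j ≟ᶜ blue)

    respects : ∀ {m m′} → (∀ i j → m i j ≡ m′ i j) → Bad m → Bad m′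
    respects e (m-sym , bad) =
      (λ i j → trans (sym (e i j)) (trans (m-sym i j) (e j i))) ,
      λ { (inj₁ r) → bad (inj₁ (copy-mono G (λ i j → trans (e i j)) r))
        ; (inj₂ b) → bad (inj₂ (copy-mono H (λ i j → trans (e i j)) b)) }

  ramsey-bound : ℕ → ℕ → ℕ
  ramsey-bound zero    t       = 0
  ramsey-bound (suc s) zero    = 0
  ramsey-bound (suc s) (suc t) = suc (ramsey-bound s (suc t) ℕ.+ ramsey-bound (suc s) t)

  module _ {N} (c : Fin N → Fin N → Colour) where

    Clique : Colour → List (Fin N) → Set
    Clique k = AllPairs λ i j → i ≢ j × c i j ≡ k

    CliqueIn : Colour → ℕ → List (Fin N) → Set
    CliqueIn k s xs = ∃ λ ys → (∀ {i} → i ∈ ys → i ∈ xs) × length ys ≡ s × Clique k ys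

    nbrs : Colour → Fin N → List (Fin N) → List (Fin N)
    nbrs k x = filter λ y → c x y ≟ᶜ k

    nbrs-length : ∀ x xs → length (nbrs red x xs) ℕ.+ length (nbrs blue x xs) ≡ length xs
    nbrs-length x [] = refl
    nbrs-length x (y ∷ ys) with c x y
    ... | red  = cong suc (nbrs-length x ys)
    ... | blue = trans (ℕ.+-suc _ _) (cong suc (nbrs-length x ys))

    extend : ∀ {k s x xs} → All (x ≢_) xs → CliqueIn k s (nbrs k x xs) → CliqueIn k (suc s) (x ∷ xs)
    extend {k} {x = x} {xs} x≢xs (ys , ys⊆ , len , clique) =
      x ∷ ys ,
      (λ { (here e) → here e ; (there i) → there (proj₁ (∈-filter⁻ (λ y → c x y ≟ᶜ k) {xs = xs} (ys⊆ i))) }) ,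
      cong suc len ,
      All.tabulate (λ i → let i∈xs , e = ∈-filter⁻ (λ y → c x y ≟ᶜ k) {xs = xs} (ys⊆ i) in
        All.lookup x≢xs i∈xs , e) ∷ clique

    weaken : ∀ {k l s x xs} → CliqueIn l s (nbrs k x xs) → CliqueIn l s (x ∷ xs)
    weaken {k} {x = x} {xs} (ys , ys⊆ , rest) =
      ys , (λ i → there (proj₁ (∈-filter⁻ (λ y → c x y ≟ᶜ k) {xs = xs} (ys⊆ i)))) , rest

    cliques : ∀ s t xs → Unique xs → ramsey-bound s t ℕ.≤ length xs →
              CliqueIn red s xs ⊎ CliqueIn blue t xs
    cliques zero t xs u h = inj₁ ([] , (λ ()) , refl , [])
    cliques (suc s) zero xs u h = inj₂ ([] , (λ ()) , refl , [])
    cliques (suc s) (suc t) (x ∷ xs) (x≢xs ∷ u) (s≤s h)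
      with ramsey-bound s (suc t) ℕ.≤? length (nbrs red x xs)
    ... | yes p = [ inj₁ ∘ extend x≢xs , inj₂ ∘ weaken ]′
      (cliques s (suc t) (nbrs red x xs) (Unique.filter⁺ _ u) p)
    ... | no ¬p = [ inj₁ ∘ weaken , inj₂ ∘ extend x≢xs ]′
      (cliques (suc s) t (nbrs blue x xs) (Unique.filter⁺ _ u)
        (ℕ.+-cancelˡ-≤ (length (nbrs red x xs)) _ _
          (ℕ.≤-trans (ℕ.+-monoˡ-≤ _ (ℕ.<⇒≤ (ℕ.≰⇒> ¬p)))
            (ℕ.≤-trans h (ℕ.≤-reflexive (sym (nbrs-length x xs)))))))

  lookup-pairs : ∀ {A : Set} {R : Rel A 0ℓ} → Symmetric R → ∀ {xs} → AllPairs R xs →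
                 ∀ i j → i ≢ j → R (lookup xs i) (lookup xs j)
  lookup-pairs s (_ ∷ _) zero zero i≢j = contradiction refl i≢j
  lookup-pairs s {_ ∷ xs} (rx ∷ _) zero (suc j) _ = All.lookup rx (∈-lookup j)
  lookup-pairs s {_ ∷ xs} (rx ∷ _) (suc i) zero _ = s (All.lookup rx (∈-lookup i))
  lookup-pairs s (_ ∷ ps) (suc i) (suc j) i≢j = lookup-pairs s ps i j (i≢j ∘ cong suc)

  clique⇒copy : ∀ {N} (c : Colouring N) k G {xs} →
                CliqueIn (Colouring.colour c) k (Graph.order G) xs →
                Copy G (λ i j → Colouring.colour c i j ≡ k)
  clique⇒copy c k G (ys , _ , len , clique) = f , inj , λ i j i~j → proj₂ (pair i j λ { refl → irrefl i~j })
    where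
    open Graph G
    open Colouring c
    f = lookup ys ∘ subst Fin (sym len)

    subst-inj : ∀ {m n} (e : m ≡ n) {i j : Fin m} → subst Fin e i ≡ subst Fin e j → i ≡ j
    subst-inj refl h = h

    pair : ∀ i j → i ≢ j → f i ≢ f j × colour (f i) (f j) ≡ k
    pair i j i≢j = lookup-pairs (λ { (a≢b , e) → ≢-sym a≢b , trans (colour-sym _ _) e }) clique _ _
      (i≢j ∘ subst-inj (sym len))

    inj : Injective _≡_ _≡_ f
    inj {i} {j} e with i Fin.≟ j
    ... | yes i≡j = i≡j
    ... | no  i≢j = contradiction e (proj₁ (pair i j i≢j))

  ramsey-theorem : ∀ G H → Arrows (ramsey-bound (Graph.order G) (Graph.order H)) G H
  ramsey-theorem G H c = [ inj₁ ∘ clique⇒copy c red G , inj₂ ∘ clique⇒copy c blue H ]′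
    (cliques (Colouring.colour c) _ _ (allFin _) (Unique.allFin⁺ _)
      (ℕ.≤-reflexive (sym (List.length-tabulate _))))

  least : ∀ {P : ℕ → Set} → U.Decidable P → ∀ n → P n → ∃ λ m → P m × (∀ k → P k → m ℕ.≤ k)
  least P? zero p = 0 , p , λ _ _ → z≤n
  least {P} P? (suc n) p with P? 0
  ... | yes p₀ = 0 , p₀ , λ _ _ → z≤n
  ... | no ¬p₀ = let m , pm , min = least (P? ∘ suc) n p in
    suc m , pm , λ { zero p₀ → contradiction p₀ ¬p₀ ; (suc k) pk → s≤s (min k pk) }

abstract
  ramsey-exists : ∀ G H → ∃ (IsRamseyNumber G H)
  ramsey-exists G H = least (λ N → arrows? N G H) _ (ramsey-theorem G H)

-- The Ramsey number r(G, H), characterised by r-isRamseyNumber.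

r : Graph → Graph → ℕ
r G H = proj₁ (ramsey-exists G H)

r-isRamseyNumber : ∀ G H → IsRamseyNumber G H (r G H)
r-isRamseyNumber G H = proj₂ (ramsey-exists G H)

InRange : ℝ → (n : ℕ) → 3 ℕ.≤ n → ℕ → Set
InRange ε n 3≤n ℓ =
  ℕ⇒ℝ ℓ ≤ᴿ (1ᴿ -ᴿ ε) *ᴿ (log n 3≤n /ᴿ loglog n 3≤n [ loglog-pos 3≤n ])

ratio : (ℓ n : ℕ) → 3 ℕ.≤ n → ℝ
ratio ℓ n 3≤n =
  ℕ⇒ℝ ((ℓ ℕ.∸ 1) ℕ.* (n ℕ.∸ 1) ℕ.+ 1) /ᴿ nlogn n 3≤n [ nlogn-pos 3≤n ]

{-# OPTIONS --safe #-}
module Submission where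

-- Choose L and M with 2^L < n ≤ 2^(L+1) and 2^M < L ≤ 2^(M+1), so that
-- log n and log log n are L and M up to 1; an ℓ in the given range
-- satisfies kMℓ ≤ (k-1)(L+1) as soon as 1/k < ε. Colour the edges on
-- 2^(L+M+4) vertices at random, red with probability 2^-(L-2-i), where
-- i = O(log M). Each vertex has about 2^(M+6+i) red neighbours, so at most
-- 2^((M+6+i)ℓ) ≤ 2^L red ℓ-cycles are expected, while by the choice of i
-- a union bound excludes blue cliques on 2^L < n vertices. Deleting one
-- vertex from every red ℓ-cycle leaves half of the vertices, which is at
-- least n(L+1) ≥ n log n. Probabilities are expressed by counting words
-- over a multiset of colours.

open import Defs hiding (_^_)
open Defs using () renaming (_^_ to _^ℚ_)
import Algebra.Properties.CommutativeSemigroup as CommutativeSemigroupProperties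
open import Data.Empty using (⊥)
open import Data.Fin.Base using (Fin; zero; suc; toℕ; combine; fromℕ<; inject≤)
import Data.Fin.Properties as Fin
open import Data.Integer.Base as ℤ using (+[1+_]; -[1+_])
import Data.Integer.Properties as ℤ
open import Data.List.Base as List using (List; []; _∷_; _++_; length; filter; allFin; replicate; cartesianProductWith)
open import Data.List.Membership.Propositional using (_∈_)
import Data.List.Membership.DecPropositional as DecMembership
open import Data.List.Membership.Propositional.Properties
import Data.List.Properties as List
open import Data.List.Relation.Binary.Sublist.Propositional as Sublist using (_⊆_; []; _∷_; _∷ʳ_; ⊆-trans)
open import Data.List.Relation.Binary.Sublist.Propositional.Properties using (take-⊆; filter-⊆)
open import Data.List.Relation.Unary.All as All using (All; []; _∷_)
import Data.List.Relation.Unary.All.Properties as All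
open import Data.List.Relation.Unary.AllPairs using ([]; _∷_)
open import Data.List.Relation.Unary.Any using (here; there; index)
open import Data.List.Relation.Unary.Any.Properties using (lookup-index)
open import Data.List.Relation.Unary.Unique.Propositional using (Unique)
import Data.List.Relation.Unary.Unique.Propositional.Properties as Unique
open import Data.Nat.Base
open import Data.Nat.Properties
open import Data.Nat.Tactic.RingSolver using (solve-∀)
open import Data.Product using (∃; _×_; _,_; proj₁; proj₂)
open import Data.Rational.Base as ℚ using (ℚ; mkℚ; 0ℚ; 1ℚ)
import Data.Rational.Properties as ℚ
open import Data.Rational.Solver using (module +-*-Solver)
import Data.Rational.Unnormalised.Base as ℚᵘ
import Data.Rational.Unnormalised.Properties as ℚᵘ
open import Data.Sum.Base using (_⊎_; inj₁; inj₂; [_,_]′)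
open import Data.Vec.Base as Vec using (Vec; []; _∷_)
import Data.Vec.Properties as Vec
open import Function.Base using (_∘_; id)
open import Function.Definitions using (Injective)
open import Relation.Binary.Definitions using (DecidableEquality; tri<; tri≈; tri>)
open import Relation.Binary.PropositionalEquality hiding ([_])
open import Relation.Nullary using (¬_; Dec; yes; no; contradiction)
open import Relation.Nullary.Decidable using (¬?; _→-dec_)
import Relation.Unary as U

-- The size of i is dictated by the cliques. Put s = 2^L and μ = L-2-i. Among 2^(M+4) s vertices
-- there are at most 2^((M+6)s) sets of size s. Each spans at least s²/4 pairs, and a block of 2^μ
-- pairs is blue with probability at most 1/2, so each set is blue with probability at most 2^-(s
-- 2^i). The union bound thus asks for 2^i ≥ M+8, that is, for a red probability larger than the
-- naive choice by a factor of order M. The cycles pay for this: the hypothesis on ℓ controls only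
-- Mℓ, while the exponent is (M+6+i)ℓ. As ℓ is at most about L/M, the excess (6+i)ℓ is of order
-- (L/M) log M, and the gap between (1-1/k)(L+1) and L absorbs it for large M. This is the only use
-- of ε in the lower bound, so ε may be replaced by a unit fraction below it. The rounding of n and
-- log n to powers of two costs only constants in these exponents, which lets the whole
-- combinatorial part run in natural numbers. The comparison of the two bounds uses no more than Mℓ
-- ≤ L+1 and the growth of M.

private
  module + = CommutativeSemigroupProperties +-commutativeSemigroup
  module * = CommutativeSemigroupProperties *-commutativeSemigroup

private
  variable
    A B C I : Set

-- Finite sums and products

∑ : List A → (A → ℕ) → ℕ
∑ []       f = 0
∑ (x ∷ xs) f = f x + ∑ xs f

∏ : ∀ {k} → (Fin k → ℕ) → ℕ
∏ {zero}  f = 1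
∏ {suc k} f = f zero * ∏ (f ∘ suc)

∑-cong : ∀ (xs : List A) {f g} → (∀ x → f x ≡ g x) → ∑ xs f ≡ ∑ xs g
∑-cong []       e = refl
∑-cong (x ∷ xs) e = cong₂ _+_ (e x) (∑-cong xs e)

∑-mono-∈ : ∀ (xs : List A) {f g} → (∀ {x} → x ∈ xs → f x ≤ g x) → ∑ xs f ≤ ∑ xs g
∑-mono-∈ []       h = z≤n
∑-mono-∈ (x ∷ xs) h = +-mono-≤ (h (here refl)) (∑-mono-∈ xs (h ∘ there))

∑-distrib-+ : ∀ (xs : List A) f g → ∑ xs (λ x → f x + g x) ≡ ∑ xs f + ∑ xs g
∑-distrib-+ []       f g = refl
∑-distrib-+ (x ∷ xs) f g =
  trans (cong (f x + g x +_) (∑-distrib-+ xs f g)) (+.interchange (f x) (g x) _ _)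

∑-*ʳ : ∀ (xs : List A) f c → ∑ xs (λ x → f x * c) ≡ ∑ xs f * c
∑-*ʳ []       f c = refl
∑-*ʳ (x ∷ xs) f c = trans (cong (f x * c +_) (∑-*ʳ xs f c)) (sym (*-distribʳ-+ c (f x) _))

∑-*ˡ : ∀ (xs : List A) f c → ∑ xs (λ x → c * f x) ≡ c * ∑ xs f
∑-*ˡ xs f c = trans (∑-cong xs λ x → *-comm c (f x)) (trans (∑-*ʳ xs f c) (*-comm _ c))

∑-const : ∀ (xs : List A) c → ∑ xs (λ _ → c) ≡ length xs * c
∑-const []       c = refl
∑-const (x ∷ xs) c = cong (c +_) (∑-const xs c)

∑-swap : ∀ (xs : List A) (ys : List B) (f : A → B → ℕ) →
         ∑ xs (λ x → ∑ ys (f x)) ≡ ∑ ys (λ y → ∑ xs (λ x → f x y))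
∑-swap []       ys f = sym (trans (∑-const ys 0) (*-zeroʳ (length ys)))
∑-swap (x ∷ xs) ys f =
  trans (cong (∑ ys (f x) +_) (∑-swap xs ys f)) (sym (∑-distrib-+ ys (f x) λ y → ∑ xs λ x → f x y))

∑-++ : ∀ (xs ys : List A) f → ∑ (xs ++ ys) f ≡ ∑ xs f + ∑ ys f
∑-++ []       ys f = refl
∑-++ (x ∷ xs) ys f = trans (cong (f x +_) (∑-++ xs ys f)) (sym (+-assoc (f x) _ _))

∑-map : ∀ (g : A → B) xs f → ∑ (List.map g xs) f ≡ ∑ xs (f ∘ g)
∑-map g []       f = refl
∑-map g (x ∷ xs) f = cong (f (g x) +_) (∑-map g xs f)

∑-cartesianProductWith : ∀ (g : A → B → C) xs ys f →
  ∑ (cartesianProductWith g xs ys) f ≡ ∑ xs (λ x → ∑ ys (λ y → f (g x y)))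
∑-cartesianProductWith g []       ys f = refl
∑-cartesianProductWith g (x ∷ xs) ys f = trans (∑-++ (List.map (g x) ys) _ f)
  (cong₂ _+_ (∑-map (g x) ys f) (∑-cartesianProductWith g xs ys f))

-- The averaging step of the probabilistic method: an expectation below `b` is witnessed by an
-- outcome below `b`.
∑<⇒∃< : ∀ (xs : List A) f b → ∑ xs f < length xs * b → ∃ λ x → f x < b
∑<⇒∃< (x ∷ xs) f b h with f x <? b
... | yes fx<b = x , fx<b
... | no  fx≮b = ∑<⇒∃< xs f b (+-cancelˡ-< b _ _ (≤-<-trans (+-monoˡ-≤ _ (≮⇒≥ fx≮b)) h))

length-filter≤∑ : ∀ {P : A → Set} (P? : U.Decidable P) {f} → (∀ x → P x → 1 ≤ f x) →
                  ∀ xs → length (filter P? xs) ≤ ∑ xs f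
length-filter≤∑ P? h []       = z≤n
length-filter≤∑ P? h (x ∷ xs) with P? x
... | yes px = +-mono-≤ (h x px) (length-filter≤∑ P? h xs)
... | no  _  = ≤-trans (length-filter≤∑ P? h xs) (m≤n+m _ _)

-- Words with independent letters, duplicate-free lists, products over coordinates

words : List A → ∀ k → List (Vec A k)
words xs zero    = [] ∷ []
words xs (suc k) = cartesianProductWith _∷_ xs (words xs k)

-- Independence in counting form: the expectation of a product of functions of separate letters is
-- the product of their expectations.
∑-words-∏ : ∀ (xs : List A) {k} (g : Fin k → A → ℕ) →
            ∑ (words xs k) (λ v → ∏ λ i → g i (Vec.lookup v i)) ≡ ∏ λ i → ∑ xs (g i)
∑-words-∏ xs {zero}  g = refl
∑-words-∏ xs {suc k} g = begin
  ∑ (words xs (suc k)) (λ v → ∏ λ i → g i (Vec.lookup v i))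
    ≡⟨ ∑-cartesianProductWith _∷_ xs (words xs k) _ ⟩
  ∑ xs (λ a → ∑ (words xs k) λ v → g zero a * ∏ λ i → g (suc i) (Vec.lookup v i))
    ≡⟨ ∑-cong xs (λ a → trans (∑-*ˡ (words xs k) _ (g zero a))
                              (cong (g zero a *_) (∑-words-∏ xs (g ∘ suc)))) ⟩
  ∑ xs (λ a → g zero a * ∏ λ i → ∑ xs (g (suc i)))
    ≡⟨ ∑-*ʳ xs (g zero) _ ⟩
  ∑ xs (g zero) * ∏ (λ i → ∑ xs (g (suc i))) ∎
  where open ≡-Reasoning

length≡∑1 : ∀ (xs : List A) → length xs ≡ ∑ xs (λ _ → 1)
length≡∑1 xs = sym (trans (∑-const xs 1) (*-identityʳ _))

length-words : ∀ (xs : List A) k → length (words xs k) ≡ length xs ^ k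
length-words xs zero    = refl
length-words xs (suc k) = begin
  length (words xs (suc k))                ≡⟨ length≡∑1 (words xs (suc k)) ⟩
  ∑ (words xs (suc k)) (λ _ → 1)           ≡⟨ ∑-cartesianProductWith _∷_ xs (words xs k) _ ⟩
  ∑ xs (λ _ → ∑ (words xs k) (λ _ → 1))    ≡⟨ ∑-const xs _ ⟩
  length xs * ∑ (words xs k) (λ _ → 1)     ≡⟨ cong (length xs *_) (length≡∑1 (words xs k)) ⟨
  length xs * length (words xs k)          ≡⟨ cong (length xs *_) (length-words xs k) ⟩
  length xs ^ suc k                        ∎
  where open ≡-Reasoning

∈-words : ∀ {xs : List A} {k} (v : Vec A k) → (∀ i → Vec.lookup v i ∈ xs) → v ∈ words xs k
∈-words []      h = here refl
∈-words (a ∷ v) h = ∈-cartesianProductWith⁺ _∷_ (h zero) (∈-words v (h ∘ suc))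

lookup-injective : ∀ {xs : List A} → Unique xs → Injective _≡_ _≡_ (List.lookup xs)
lookup-injective (_ ∷ _) {zero}  {zero}  _ = refl
lookup-injective (x∉ ∷ _) {zero}  {suc j} e = contradiction e (All.lookup x∉ (∈-lookup j))
lookup-injective (x∉ ∷ _) {suc i} {zero}  e = contradiction (sym e) (All.lookup x∉ (∈-lookup i))
lookup-injective (_ ∷ u) {suc i} {suc j} e = cong suc (lookup-injective u e)

Unique-⊆⇒length≤ : ∀ {xs ys : List A} → Unique xs → (∀ {x} → x ∈ xs → x ∈ ys) → length xs ≤ length ys
Unique-⊆⇒length≤ {xs = xs} {ys} u xs⊆ys = Fin.injective⇒≤ {f = f} inj
  where
  f : Fin (length xs) → Fin (length ys)
  f i = index (xs⊆ys (∈-lookup i))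

  inj : Injective _≡_ _≡_ f
  inj {i} {j} e = lookup-injective u (trans (lookup-index (xs⊆ys (∈-lookup i)))
    (trans (cong (List.lookup ys) e) (sym (lookup-index (xs⊆ys (∈-lookup j))))))

∏-cong : ∀ {k} {f g : Fin k → ℕ} → (∀ i → f i ≡ g i) → ∏ f ≡ ∏ g
∏-cong {zero}  e = refl
∏-cong {suc k} e = cong₂ _*_ (e zero) (∏-cong (e ∘ suc))

if-dec : {P : Set} → Dec P → ℕ → ℕ → ℕ
if-dec (yes _) a b = a
if-dec (no _)  a b = b

-- The product is a^c m^(k-c); the factor `m ^ c` on the left avoids the subtraction. The family `f`
-- generalises `id`, which an induction on `k` would not preserve.
∏-if-dec : ∀ {P : I → Set} (P? : U.Decidable P) a m {k} (f : Fin k → I) →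
  let c = length (filter P? (List.tabulate f)) in
  ∏ (λ i → if-dec (P? (f i)) a m) * m ^ c ≡ a ^ c * m ^ k
∏-if-dec P? a m {zero}  f = refl
∏-if-dec P? a m {suc k} f with P? (f zero) | ∏-if-dec P? a m (f ∘ suc)
... | yes _ | ih = trans (*.interchange a _ m _) (trans (cong (a * m *_) ih)
  (*.interchange a m (a ^ length (filter P? (List.tabulate (f ∘ suc)))) (m ^ k)))
... | no  _ | ih = trans (*-assoc m _ _) (trans (cong (m *_) ih)
  (*.x∙yz≈y∙xz m (a ^ length (filter P? (List.tabulate (f ∘ suc)))) (m ^ k)))

-- Colour words

matches : Colour → Colour → ℕ
matches red  red  = 1
matches red  blue = 0
matches blue red  = 0
matches blue blue = 1

matches-refl : ∀ c → matches c c ≡ 1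
matches-refl red  = refl
matches-refl blue = refl

_≟ᶜ_ : DecidableEquality Colour
red  ≟ᶜ red  = yes refl
red  ≟ᶜ blue = no λ ()
blue ≟ᶜ red  = no λ ()
blue ≟ᶜ blue = yes refl

-- A uniformly random letter is red with probability 1 / (1 + x).

palette : ℕ → List Colour
palette x = red ∷ replicate x blue

multiplicity : ℕ → Colour → ℕ
multiplicity x red  = 1
multiplicity x blue = x

∑-replicate : ∀ k (a : A) f → ∑ (replicate k a) f ≡ k * f a
∑-replicate zero    a f = refl
∑-replicate (suc k) a f = cong (f a +_) (∑-replicate k a f)

length-palette : ∀ x → length (palette x) ≡ suc x
length-palette x = cong suc (List.length-replicate x)

∑-palette : ∀ x c → ∑ (palette x) (matches c) ≡ multiplicity x c
∑-palette x red  = cong suc (trans (∑-replicate x blue (matches red)) (*-zeroʳ x))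
∑-palette x blue = trans (∑-replicate x blue (matches blue)) (*-identityʳ x)

Mono : ∀ {K} → Colour → Vec Colour K → List (Fin K) → Set
Mono c ω = All λ e → Vec.lookup ω e ≡ c

mono? : ∀ {K} c (ω : Vec Colour K) → U.Decidable (Mono c ω)
mono? c ω = All.all? λ e → Vec.lookup ω e ≟ᶜ c

module _ {K : ℕ} where

  open DecMembership (Fin._≟_ {K}) using (_∈?_)

  factor : {P : Set} → Dec P → Colour → Colour → ℕ
  factor d c a = if-dec d (matches c a) 1

  -- The indicator of `Mono c ω es`, spread over all coordinates with a neutral 1 outside `es`, so
  -- that `∑-words-∏` applies to it.
  monoWeight : Colour → List (Fin K) → Vec Colour K → ℕ
  monoWeight c es ω = ∏ λ i → factor (i ∈? es) c (Vec.lookup ω i)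

  Mono⇒1≤monoWeight : ∀ c es ω → Mono c ω es → 1 ≤ monoWeight c es ω
  Mono⇒1≤monoWeight c es ω h = ≤-reflexive (sym (all-one λ i → factor≡1 i (i ∈? es)))
    where
    factor≡1 : ∀ i (d : Dec (i ∈ es)) → factor d c (Vec.lookup ω i) ≡ 1
    factor≡1 i (yes i∈es) rewrite All.lookup h i∈es = matches-refl c
    factor≡1 i (no _) = refl
    all-one : ∀ {k} {f : Fin k → ℕ} → (∀ i → f i ≡ 1) → ∏ f ≡ 1
    all-one {zero}  e = refl
    all-one {suc k} e = cong₂ _*_ (e zero) (all-one (e ∘ suc))

  -- Distinct letters are independent, so the event has probability (a/m)^count, where `count` is at
  -- least `t` since `es` has no repetitions; as a ≤ m, the surplus factors only help. Denominators
  -- are multiplied out.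
  ∑-monoWeight : ∀ x c es t → Unique es → t ≤ length es →
    ∑ (words (palette x) K) (monoWeight c es) * suc x ^ t ≤ multiplicity x c ^ t * suc x ^ K
  ∑-monoWeight x c es t u t≤ = cancel (count ∸ t , m+[n∸m]≡n t≤count)
    where
    m = suc x
    a = multiplicity x c

    a≤m : ∀ c → multiplicity x c ≤ m
    a≤m red  = s≤s z≤n
    a≤m blue = n≤1+n x

    X = ∑ (words (palette x) K) (monoWeight c es)
    count = length (filter (_∈? es) (allFin K))

    t≤count : t ≤ count
    t≤count = ≤-trans t≤ (Unique-⊆⇒length≤ u λ {e} → ∈-filter⁺ (_∈? es) (∈-allFin e))

    letter : ∀ {P : Set} (d : Dec P) → ∑ (palette x) (factor d c) ≡ if-dec d a m
    letter (yes _) = ∑-palette x c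
    letter (no _)  = trans (sym (length≡∑1 (palette x))) (length-palette x)

    product : X * m ^ count ≡ a ^ count * m ^ K
    product = trans (cong (_* m ^ count)
      (trans (∑-words-∏ (palette x) (λ i → factor (i ∈? es) c)) (∏-cong λ i → letter (i ∈? es))))
      (∏-if-dec (_∈? es) a m {K} id)

    cancel : (∃ λ d → t + d ≡ count) → X * m ^ t ≤ a ^ t * m ^ K
    cancel (d , eq) = *-cancelʳ-≤ _ _ (m ^ d) {{m^n≢0 m d}} (begin
      X * m ^ t * m ^ d          ≡⟨ *-assoc X _ _ ⟩
      X * (m ^ t * m ^ d)        ≡⟨ cong (X *_) (^-distribˡ-+-* m t d) ⟨
      X * m ^ (t + d)            ≡⟨ cong (λ z → X * m ^ z) eq ⟩
      X * m ^ count              ≡⟨ product ⟩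
      a ^ count * m ^ K          ≡⟨ cong (λ z → a ^ z * m ^ K) eq ⟨
      a ^ (t + d) * m ^ K        ≡⟨ cong (_* m ^ K) (^-distribˡ-+-* a t d) ⟩
      a ^ t * a ^ d * m ^ K      ≤⟨ *-monoˡ-≤ (m ^ K) (*-monoʳ-≤ (a ^ t) (^-monoˡ-≤ d (a≤m c))) ⟩
      a ^ t * m ^ d * m ^ K      ≡⟨ *.xy∙z≈xz∙y (a ^ t) (m ^ d) (m ^ K) ⟩
      a ^ t * m ^ K * m ^ d      ∎)
      where open ≤-Reasoning

  -- Linearity of expectation over the events in `as`.
  ∑∑-monoWeight : ∀ x c (as : List A) (es : A → List (Fin K)) t →
    (∀ {a} → a ∈ as → Unique (es a) × t ≤ length (es a)) →
    ∑ (words (palette x) K) (λ ω → ∑ as λ a → monoWeight c (es a) ω) * suc x ^ t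
      ≤ length as * (multiplicity x c ^ t * suc x ^ K)
  ∑∑-monoWeight x c as es t h = begin
    ∑ Ω (λ ω → ∑ as λ a → monoWeight c (es a) ω) * suc x ^ t
      ≡⟨ cong (_* suc x ^ t) (∑-swap Ω as _) ⟩
    ∑ as (λ a → ∑ Ω (monoWeight c (es a))) * suc x ^ t
      ≡⟨ ∑-*ʳ as _ _ ⟨
    ∑ as (λ a → ∑ Ω (monoWeight c (es a)) * suc x ^ t)
      ≤⟨ ∑-mono-∈ as (λ a∈as → ∑-monoWeight x c _ t (proj₁ (h a∈as)) (proj₂ (h a∈as))) ⟩
    ∑ as (λ _ → multiplicity x c ^ t * suc x ^ K)
      ≡⟨ ∑-const as _ ⟩
    length as * (multiplicity x c ^ t * suc x ^ K) ∎
    where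
    open ≤-Reasoning
    Ω = words (palette x) K

  -- The first moment method: weighting blue events by 1 + 2q, the expected
  -- total weight is below 1 + 2q.
  few-red-no-blue : ∀ x (as : List A) (esᴬ : A → List (Fin K)) (bs : List B) (esᴮ : B → List (Fin K)) {ℓ t q} →
    (∀ {a} → a ∈ as → Unique (esᴬ a) × ℓ ≤ length (esᴬ a)) →
    (∀ {b} → b ∈ bs → Unique (esᴮ b) × t ≤ length (esᴮ b)) →
    length as ≤ q * suc x ^ ℓ →
    4 * (length bs * x ^ t) ≤ suc x ^ t →
    ∃ λ ω → length (filter (mono? red ω ∘ esᴬ) as) ≤ 2 * q ×
            length (filter (mono? blue ω ∘ esᴮ) bs) ≡ 0
  few-red-no-blue x as esᴬ bs esᴮ {ℓ} {t} {q} hᴬ hᴮ as≤ bs≤ = finish (∑<⇒∃< Ω F X total)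
    where
    open ≤-Reasoning
    m = suc x
    X = suc (2 * q)
    Ω = words (palette x) K

    Fᴬ Fᴮ F : Vec Colour K → ℕ
    Fᴬ ω = ∑ as λ a → monoWeight red (esᴬ a) ω
    Fᴮ ω = ∑ bs λ b → monoWeight blue (esᴮ b) ω
    F ω = Fᴬ ω + X * Fᴮ ω

    boundᴬ : ∑ Ω Fᴬ ≤ q * m ^ K
    boundᴬ = *-cancelʳ-≤ _ _ (m ^ ℓ) {{m^n≢0 m ℓ}} (begin
      ∑ Ω Fᴬ * m ^ ℓ                    ≤⟨ ∑∑-monoWeight x red as esᴬ ℓ hᴬ ⟩
      length as * (1 ^ ℓ * m ^ K)       ≡⟨ cong (λ z → length as * (z * m ^ K)) (^-zeroˡ ℓ) ⟩
      length as * (1 * m ^ K)           ≡⟨ cong (length as *_) (*-identityˡ (m ^ K)) ⟩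
      length as * m ^ K                 ≤⟨ *-monoˡ-≤ (m ^ K) as≤ ⟩
      q * m ^ ℓ * m ^ K                 ≡⟨ *.xy∙z≈xz∙y q (m ^ ℓ) (m ^ K) ⟩
      q * m ^ K * m ^ ℓ                 ∎)

    boundᴮ : 4 * ∑ Ω Fᴮ ≤ m ^ K
    boundᴮ = *-cancelʳ-≤ _ _ (m ^ t) {{m^n≢0 m t}} (begin
      4 * ∑ Ω Fᴮ * m ^ t                  ≡⟨ *-assoc 4 (∑ Ω Fᴮ) (m ^ t) ⟩
      4 * (∑ Ω Fᴮ * m ^ t)                ≤⟨ *-monoʳ-≤ 4 (∑∑-monoWeight x blue bs esᴮ t hᴮ) ⟩
      4 * (length bs * (x ^ t * m ^ K))   ≡⟨ regroup 4 (length bs) (x ^ t) (m ^ K) ⟩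
      m ^ K * (4 * (length bs * x ^ t))   ≤⟨ *-monoʳ-≤ (m ^ K) bs≤ ⟩
      m ^ K * m ^ t                       ∎)
      where
      regroup : ∀ n a b c → n * (a * (b * c)) ≡ c * (n * (a * b))
      regroup = solve-∀

    -- In units of m^K the total is at most q + X/4 = (6q+1)/4, which is less than X = 2q+1.
    total : ∑ Ω F < length Ω * X
    total = *-cancelˡ-< 4 _ _ (begin-strict
      4 * ∑ Ω F                              ≡⟨ cong (4 *_) (∑-distrib-+ Ω Fᴬ _) ⟩
      4 * (∑ Ω Fᴬ + ∑ Ω (λ ω → X * Fᴮ ω))    ≡⟨ cong (λ z → 4 * (∑ Ω Fᴬ + z)) (∑-*ˡ Ω Fᴮ X) ⟩
      4 * (∑ Ω Fᴬ + X * ∑ Ω Fᴮ)              ≡⟨ expand (∑ Ω Fᴬ) X (∑ Ω Fᴮ) ⟩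
      4 * ∑ Ω Fᴬ + X * (4 * ∑ Ω Fᴮ)          ≤⟨ +-mono-≤ (*-monoʳ-≤ 4 boundᴬ) (*-monoʳ-≤ X boundᴮ) ⟩
      4 * (q * m ^ K) + X * m ^ K            ≡⟨ collect q (m ^ K) ⟩
      m ^ K * (6 * q + 1)                    <⟨ *-monoʳ-< (m ^ K) {{m^n≢0 m K}} (slack q) ⟩
      m ^ K * (4 * X)                        ≡⟨ cong (_* (4 * X)) (trans (length-words (palette x) K)
                                                  (cong (_^ K) (length-palette x))) ⟨
      length Ω * (4 * X)                     ≡⟨ *.x∙yz≈y∙xz (length Ω) 4 X ⟩
      4 * (length Ω * X)                     ∎)
      where
      expand : ∀ a b c → 4 * (a + b * c) ≡ 4 * a + b * (4 * c)
      expand = solve-∀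
      collect : ∀ q k → 4 * (q * k) + suc (2 * q) * k ≡ k * (6 * q + 1)
      collect = solve-∀
      slack : ∀ q → 6 * q + 1 < 4 * suc (2 * q)
      slack q = ≤-trans (m≤n+m _ (2 * q + 2)) (≤-reflexive (eq q))
        where
        eq : ∀ q → 2 * q + 2 + suc (6 * q + 1) ≡ 4 * suc (2 * q)
        eq = solve-∀

    -- A single blue event would already weigh X, so a word of weight below X has none, and it has
    -- at most X-1 = 2q red ones.
    finish : (∃ λ ω → F ω < X) → _
    finish (ω , Fω<X) = ω ,
      ≤-trans (length-filter≤∑ _ (λ a → Mono⇒1≤monoWeight red (esᴬ a) ω) as)
        (s≤s⁻¹ (≤-<-trans (m≤m+n (Fᴬ ω) _) Fω<X)) ,
      n<1⇒n≡0 (≤-<-trans (length-filter≤∑ _ (λ b → Mono⇒1≤monoWeight blue (esᴮ b) ω) bs)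
        (*-cancelˡ-< X _ _ (≤-<-trans (m≤n+m (X * Fᴮ ω) (Fᴬ ω))
          (<-≤-trans Fω<X (≤-reflexive (sym (*-identityʳ X)))))))

-- Unordered pairs and sublists of given length

private
  variable
    N : ℕ

-- An unordered pair is coded with its smaller end first, so that both orders of the pair name the
-- same letter of the random word.
key : Fin N → Fin N → Fin (N * N)
key i j with toℕ i ≤? toℕ j
... | yes _ = combine i j
... | no  _ = combine j i

key-comm : ∀ (i j : Fin N) → key i j ≡ key j i
key-comm i j with toℕ i ≤? toℕ j | toℕ j ≤? toℕ i
... | yes p | yes q = cong₂ combine i≡j (sym i≡j)
  where i≡j = Fin.toℕ-injective (≤-antisym p q)
... | yes p | no  _ = refl
... | no  _ | yes _ = refl
... | no  p | no  q = contradiction (≤-total (toℕ i) (toℕ j)) [ p , q ]′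

key-injective : ∀ (i j k l : Fin N) → key i j ≡ key k l → (i ≡ k × j ≡ l) ⊎ (i ≡ l × j ≡ k)
key-injective i j k l e with toℕ i ≤? toℕ j | toℕ k ≤? toℕ l
... | yes _ | yes _ = inj₁ (Fin.combine-injective i j k l e)
... | yes _ | no  _ = inj₂ (Fin.combine-injective i j l k e)
... | no  _ | yes _ = let j≡k , i≡l = Fin.combine-injective j i k l e in inj₂ (i≡l , j≡k)
... | no  _ | no  _ = let j≡l , i≡k = Fin.combine-injective j i l k e in inj₁ (i≡k , j≡l)

pairs : List (Fin N) → List (Fin (N * N))
pairs []       = []
pairs (y ∷ ys) = List.map (key y) ys ++ pairs ys

pairs-All : ∀ {P : Fin (N * N) → Set} {ys : List (Fin N)} → Unique ys →
            (∀ {y z} → y ∈ ys → z ∈ ys → y ≢ z → P (key y z)) → All P (pairs ys)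
pairs-All []       h = []
pairs-All (y∉ ∷ u) h = All.++⁺
  (All.map⁺ (All.tabulate λ z∈ys → h (here refl) (there z∈ys) (All.lookup y∉ z∈ys)))
  (pairs-All u λ y∈ys z∈ys → h (there y∈ys) (there z∈ys))

pairs-Unique : ∀ {ys : List (Fin N)} → Unique ys → Unique (pairs ys)
pairs-Unique {ys = []}     []       = []
pairs-Unique {ys = y ∷ ys} (y∉ ∷ u) =
  Unique.++⁺ (Unique.map⁺ key-injʳ u) (pairs-Unique u) disjoint
  where
  key-injʳ : ∀ {a b} → key y a ≡ key y b → a ≡ b
  key-injʳ {a} {b} e with key-injective y a y b e
  ... | inj₁ (_ , a≡b)   = a≡b
  ... | inj₂ (y≡b , a≡y) = trans a≡y y≡b

  avoids : All (λ e → ∀ {a} → e ≢ key y a) (pairs ys)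
  avoids = pairs-All u λ {b} {c} b∈ c∈ _ {a} e → [ (λ (b≡y , _) → All.lookup y∉ b∈ (sym b≡y)) ,
    (λ (_ , c≡y) → All.lookup y∉ c∈ (sym c≡y)) ]′ (key-injective b c y a e)

  disjoint : ∀ {e} → ¬ (e ∈ List.map (key y) ys × e ∈ pairs ys)
  disjoint (e∈₁ , e∈₂) = let _ , _ , e≡ = ∈-map⁻ (key y) e∈₁ in All.lookup avoids e∈₂ e≡

length-pairs : ∀ (ys : List (Fin N)) →
               2 * length (pairs ys) + length ys ≡ length ys * length ys
length-pairs []       = refl
length-pairs (y ∷ ys) = begin
  2 * length (List.map (key y) ys ++ pairs ys) + suc l
    ≡⟨ cong (λ z → 2 * z + suc l) (trans (List.length-++ (List.map (key y) ys))
         (cong (_+ length (pairs ys)) (List.length-map (key y) ys))) ⟩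
  2 * (l + length (pairs ys)) + suc l
    ≡⟨ regroup l (length (pairs ys)) ⟩
  2 * l + 1 + (2 * length (pairs ys) + l)
    ≡⟨ cong (2 * l + 1 +_) (length-pairs ys) ⟩
  2 * l + 1 + l * l
    ≡⟨ square l ⟩
  suc l * suc l ∎
  where
  open ≡-Reasoning
  l = length ys
  regroup : ∀ l p → 2 * (l + p) + suc l ≡ 2 * l + 1 + (2 * p + l)
  regroup = solve-∀
  square : ∀ l → 2 * l + 1 + l * l ≡ suc l * suc l
  square = solve-∀

-- A clique of even order 2h has h(2h-1) edges. Rounding this down to h² gives an exponent that is a
-- power of two whenever `h` is one.
h²≤length-pairs : ∀ h (ys : List (Fin N)) → length ys ≡ h + h → h * h ≤ length (pairs ys)
h²≤length-pairs h ys e = *-cancelˡ-≤ 2 (+-cancelʳ-≤ (h + h) _ _ (begin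
  2 * (h * h) + (h + h)                ≤⟨ +-monoʳ-≤ (2 * (h * h)) (h+h≤2h² h) ⟩
  2 * (h * h) + 2 * (h * h)            ≡⟨ square h ⟩
  (h + h) * (h + h)                    ≡⟨ cong (λ l → l * l) e ⟨
  length ys * length ys                ≡⟨ length-pairs ys ⟨
  2 * length (pairs ys) + length ys    ≡⟨ cong (2 * length (pairs ys) +_) e ⟩
  2 * length (pairs ys) + (h + h)      ∎))
  where
  open ≤-Reasoning
  square : ∀ h → 2 * (h * h) + 2 * (h * h) ≡ (h + h) * (h + h)
  square = solve-∀
  h+h≤2h² : ∀ h → h + h ≤ 2 * (h * h)
  h+h≤2h² zero      = z≤n
  h+h≤2h² h@(suc _) = ≤-trans (≤-reflexive (cong (h +_) (sym (+-identityʳ h))))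
    (*-monoʳ-≤ 2 (m≤m*n h h))

choose : ℕ → List A → List (List A)
choose zero    xs       = [] ∷ []
choose (suc s) []       = []
choose (suc s) (x ∷ xs) = List.map (x ∷_) (choose s xs) ++ choose (suc s) xs

⊆⇒∈-choose : ∀ {ys xs : List A} → ys ⊆ xs → ys ∈ choose (length ys) xs
⊆⇒∈-choose [] = here refl
⊆⇒∈-choose {ys = []}     (x ∷ʳ τ)   = here refl
⊆⇒∈-choose {ys = y ∷ ys} (x ∷ʳ τ)   = ∈-++⁺ʳ _ (⊆⇒∈-choose τ)
⊆⇒∈-choose               (refl ∷ τ) = ∈-++⁺ˡ (∈-map⁺ _ (⊆⇒∈-choose τ))

∈-choose⇒ : ∀ s (xs : List A) {ys} → Unique xs → ys ∈ choose s xs →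
            Unique ys × length ys ≡ s × (∀ {y} → y ∈ ys → y ∈ xs)
∈-choose⇒ zero    xs       u        (here refl) = [] , refl , λ ()
∈-choose⇒ (suc s) (x ∷ xs) (x∉ ∷ u) ys∈ with ∈-++⁻ (List.map (x ∷_) (choose s xs)) ys∈
... | inj₁ ys∈ˡ with ∈-map⁻ (x ∷_) ys∈ˡ
...   | zs , zs∈ , refl =
  let zs! , len , zs⊆ = ∈-choose⇒ s xs u zs∈ in
  All.tabulate (All.lookup x∉ ∘ zs⊆) ∷ zs! , cong suc len ,
  λ { (here e) → here e ; (there i) → there (zs⊆ i) }
∈-choose⇒ (suc s) (x ∷ xs) (x∉ ∷ u) ys∈ | inj₂ ys∈ʳ =
  let ys! , len , ys⊆ = ∈-choose⇒ (suc s) xs u ys∈ʳ in ys! , len , there ∘ ys⊆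

-- The term of index s in the binomial expansion of (1 + h) ^ length xs.
length-choose : ∀ h s (xs : List A) →
                length (choose s xs) * h ^ length xs ≤ h ^ s * suc h ^ length xs
length-choose h zero xs = *-monoʳ-≤ 1 (^-monoˡ-≤ (length xs) (n≤1+n h))
length-choose h (suc s) [] = z≤n
length-choose h (suc s) (x ∷ xs) = begin
  length (List.map (x ∷_) (choose s xs) ++ choose (suc s) xs) * (h * P)
    ≡⟨ cong (_* (h * P)) (trans (List.length-++ (List.map (x ∷_) (choose s xs)))
         (cong (_+ length (choose (suc s) xs)) (List.length-map (x ∷_) (choose s xs)))) ⟩
  (length (choose s xs) + length (choose (suc s) xs)) * (h * P)
    ≡⟨ split (length (choose s xs)) _ h P ⟩
  h * (length (choose s xs) * P) + h * (length (choose (suc s) xs) * P)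
    ≤⟨ +-mono-≤ (*-monoʳ-≤ h (length-choose h s xs)) (*-monoʳ-≤ h (length-choose h (suc s) xs)) ⟩
  h * (h ^ s * Q) + h * (h * h ^ s * Q)
    ≡⟨ merge h (h ^ s) Q ⟩
  h * h ^ s * (suc h * Q) ∎
  where
  open ≤-Reasoning
  P = h ^ length xs
  Q = suc h ^ length xs
  split : ∀ a b h p → (a + b) * (h * p) ≡ h * (a * p) + h * (b * p)
  split = solve-∀
  merge : ∀ h k q → h * (k * q) + h * (h * k * q) ≡ h * k * (suc h * q)
  merge = solve-∀

-- Deleting a vertex from every red cycle of a random colouring

Distinct : ∀ {k} → Vec (Fin N) k → Set
Distinct v = ∀ i j → Vec.lookup v i ≡ Vec.lookup v j → i ≡ j

distinct? : ∀ {k} → U.Decidable (Distinct {N} {k})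
distinct? v = Fin.all? λ i → Fin.all? λ j → (Vec.lookup v i Fin.≟ Vec.lookup v j) →-dec (i Fin.≟ j)

next : ∀ {k} → Fin (suc k) → Fin (suc k)
next {k} i with suc (toℕ i) <? suc k
... | yes lt = fromℕ< lt
... | no  _  = zero

next-Next : ∀ {k} (i : Fin (suc k)) → Next i (next i)
next-Next {k} i with suc (toℕ i) <? suc k
... | yes lt = inj₁ (sym (Fin.toℕ-fromℕ< lt))
... | no ≮   = inj₂ (≤-antisym (Fin.toℕ<n i) (≮⇒≥ ≮) , refl)

-- On two vertices the cycle would run through the same pair twice; `3 ≤ ℓ` excludes this, so that a
-- cycle has ℓ different edges.
¬Next² : ∀ {ℓ} → 3 ≤ ℓ → {i j : Fin ℓ} → Next i j → ¬ Next j i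
¬Next² 3≤ℓ (inj₁ p) (inj₁ q) = <-asym (≤-reflexive p) (≤-reflexive q)
¬Next² 3≤ℓ (inj₁ p) (inj₂ (q , z)) = <⇒≱ 3≤ℓ (≤-reflexive (trans (sym q) (cong suc (trans (sym p) (cong suc z)))))
¬Next² 3≤ℓ (inj₂ (p , z)) (inj₁ q) = <⇒≱ 3≤ℓ (≤-reflexive (trans (sym p) (cong suc (trans (sym q) (cong suc z)))))
¬Next² 3≤ℓ (inj₂ (_ , z)) (inj₂ (q , _)) = <⇒≱ 3≤ℓ (≤-trans (≤-reflexive (trans (sym q) (cong suc z))) (n≤1+n 1))

module _ {k : ℕ} (3≤ℓ : 3 ≤ suc k) where

  cycleEdges : Vec (Fin N) (suc k) → List (Fin (N * N))
  cycleEdges v = List.tabulate λ t → key (Vec.lookup v t) (Vec.lookup v (next t))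

  cycleEdges-Unique : ∀ (v : Vec (Fin N) (suc k)) → Distinct v → Unique (cycleEdges v)
  cycleEdges-Unique v d = Unique.tabulate⁺ λ {t} {t′} e → case t t′ (key-injective _ _ _ _ e)
    where
    case : ∀ t t′ → _ → t ≡ t′
    case t t′ (inj₁ (e , _))  = d t t′ e
    -- Equal keys with exchanged ends would make `t` and `t′` successors of each other.
    case t t′ (inj₂ (e , e′)) = contradiction
      (subst (Next t′) (sym (d _ _ e)) (next-Next t′))
      (¬Next² 3≤ℓ (subst (Next t) (d _ _ e′) (next-Next t)))

-- The first two hypotheses are expectations for red probability 1/(1+x): at most `q` red cycles,
-- and at most 1/4 blue cliques of order h + h. The third says that `R` vertices survive the
-- deletion of 2q.
¬Arrows : ∀ {ℓ} (3≤ℓ : 3 ≤ ℓ) x h n q {N R} →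
  N ^ ℓ ≤ q * suc x ^ ℓ →
  4 * (length (choose (h + h) (allFin N)) * x ^ (h * h)) ≤ suc x ^ (h * h) →
  R + 2 * q ≤ N → h + h ≤ n →
  ¬ Arrows R (cycle ℓ 3≤ℓ) (complete n)
¬Arrows {suc k} 3≤ℓ x h n q {N} {R} cycles≤ cliques≤ R+2q≤N s≤n arrows =
  let ω , few , none = few-red-no-blue x cycles (cycleEdges 3≤ℓ) cliques pairs {q = q}
        cycle-edges clique-edges
        (≤-trans (≤-trans (List.length-filter distinct? (words (allFin N) (suc k)))
          (≤-reflexive (trans (length-words (allFin N) (suc k)) (cong (_^ suc k) (List.length-tabulate {n = N} id)))))
          cycles≤)
        cliques≤
  in delete ω few none
  where
  open DecMembership (Fin._≟_ {N}) using (_∈?_)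

  s = h + h
  -- A cycle appears once for each starting point and direction; the crude count N^ℓ tolerates this.
  -- Distinctness makes the edges distinct letters.
  cycles = filter distinct? (words (allFin N) (suc k))
  cliques = choose s (allFin N)

  cycle-edges : ∀ {v} → v ∈ cycles → Unique (cycleEdges 3≤ℓ v) × suc k ≤ length (cycleEdges 3≤ℓ v)
  cycle-edges {v} v∈ = cycleEdges-Unique 3≤ℓ v (proj₂ (∈-filter⁻ distinct? {xs = words (allFin N) (suc k)} v∈)) ,
    ≤-reflexive (sym (List.length-tabulate λ t → key (Vec.lookup v t) (Vec.lookup v (next t))))

  clique-edges : ∀ {ys} → ys ∈ cliques → Unique (pairs ys) × h * h ≤ length (pairs ys)
  clique-edges {ys} ys∈ = let ys! , len , _ = ∈-choose⇒ s (allFin N) (Unique.allFin⁺ N) ys∈ in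
    pairs-Unique ys! , h²≤length-pairs h ys len

  module _ (ω : Vec Colour (N * N))
           (few : length (filter (mono? red ω ∘ cycleEdges 3≤ℓ) cycles) ≤ 2 * q)
           (none : length (filter (mono? blue ω ∘ pairs) cliques) ≡ 0) where

    redCycles = filter (mono? red ω ∘ cycleEdges 3≤ℓ) cycles
    removed = List.map (λ v → Vec.lookup v zero) redCycles
    alive = filter (λ i → ¬? (i ∈? removed)) (allFin N)

    R≤alive : R ≤ length alive
    R≤alive = +-cancelʳ-≤ (2 * q) _ _ (begin
      R + 2 * q                         ≤⟨ R+2q≤N ⟩
      N                                 ≡⟨ List.length-tabulate {n = N} id ⟨
      length (allFin N)                 ≤⟨ Unique-⊆⇒length≤ (Unique.allFin⁺ N) (λ {i} _ → split i) ⟩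
      length (alive ++ removed)         ≡⟨ List.length-++ alive ⟩
      length alive + length removed     ≡⟨ cong (length alive +_) (List.length-map _ redCycles) ⟩
      length alive + length redCycles   ≤⟨ +-monoʳ-≤ (length alive) few ⟩
      length alive + 2 * q              ∎)
      where
      open ≤-Reasoning
      split : ∀ i → i ∈ alive ++ removed
      split i with i ∈? removed
      ... | yes p = ∈-++⁺ʳ alive p
      ... | no ¬p = ∈-++⁺ˡ (∈-filter⁺ (λ i → ¬? (i ∈? removed)) (∈-allFin i) ¬p)

    g : Fin R → Fin N
    g i = List.lookup alive (inject≤ i R≤alive)

    g-injective : Injective _≡_ _≡_ g
    g-injective e = Fin.inject≤-injective R≤alive R≤alive _ _
      (lookup-injective (Unique.filter⁺ _ (Unique.allFin⁺ N)) e)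

    colouring : Colouring R
    colouring = record
      { colour     = λ i j → Vec.lookup ω (key (g i) (g j))
      ; colour-sym = λ i j → cong (Vec.lookup ω) (key-comm (g i) (g j))
      }

    no-red : ¬ Copy (cycle (suc k) 3≤ℓ) (λ i j → Colouring.colour colouring i j ≡ red)
    -- A red copy among the survivors is itself listed in `redCycles`, so its initial vertex was
    -- removed.
    no-red (f , inj , hom) = proj₂ (∈-filter⁻ (λ i → ¬? (i ∈? removed)) {xs = allFin N} (∈-lookup _))
      (∈-map⁺ (λ v → Vec.lookup v zero)
        (∈-filter⁺ (mono? red ω ∘ cycleEdges 3≤ℓ)
          (∈-filter⁺ distinct? (∈-words v (λ i → ∈-allFin _)) distinct)
          (All.tabulate⁺ λ t → trans (cong (Vec.lookup ω) (cong₂ key (v-lookup t) (v-lookup (next t))))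
            (hom t (next t) (inj₁ (next-Next t))))))
      where
      v = Vec.tabulate (g ∘ f)

      v-lookup : ∀ i → Vec.lookup v i ≡ g (f i)
      v-lookup = Vec.lookup∘tabulate (g ∘ f)

      distinct : Distinct v
      distinct i j e = inj (g-injective (trans (sym (v-lookup i)) (trans e (v-lookup j))))

    no-blue : ¬ Copy (complete n) (λ i j → Colouring.colour colouring i j ≡ blue)
    no-blue (f , inj , hom) = nonempty none (∈-filter⁺ (mono? blue ω ∘ pairs) {x = ys} ys∈ mono)
      where
      nonempty : ∀ {A : Set} {a : A} {as} → length as ≡ 0 → ¬ (a ∈ as)
      nonempty () (here _)
      nonempty () (there _)

      f′ : Fin s → Fin N
      f′ i = g (f (inject≤ i s≤n))

      f′-injective : Injective _≡_ _≡_ f′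
      f′-injective e = Fin.inject≤-injective s≤n s≤n _ _ (inj (g-injective e))

      image = List.tabulate f′
      -- A copy may list its vertices in any order, while `choose` contains only sublists of
      -- `allFin N`; filtering `allFin N` sorts the image.
      zs = filter (_∈? image) (allFin N)
      ys = List.take s zs

      length-ys : length ys ≡ s
      length-ys = trans (List.length-take s zs) (m≤n⇒m⊓n≡m (≤-trans
        (≤-reflexive (sym (List.length-tabulate f′)))
        (Unique-⊆⇒length≤ (Unique.tabulate⁺ f′-injective) λ {i} → ∈-filter⁺ (_∈? image) (∈-allFin i))))

      ys∈ : ys ∈ cliques
      ys∈ = subst (λ l → ys ∈ choose l (allFin N)) length-ys
        (⊆⇒∈-choose (⊆-trans (take-⊆ s zs) (filter-⊆ (_∈? image) (allFin N))))

      in-image : ∀ {y} → y ∈ ys → ∃ λ i → y ≡ f′ i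
      in-image y∈ = ∈-tabulate⁻ (proj₂ (∈-filter⁻ (_∈? image) {xs = allFin N} (Sublist.lookup (take-⊆ s zs) y∈)))

      mono : Mono blue ω (pairs ys)
      mono = pairs-All (proj₁ (∈-choose⇒ s (allFin N) (Unique.allFin⁺ N) ys∈)) λ y∈ z∈ y≢z →
        blue-edge (in-image y∈) (in-image z∈) y≢z
        where
        blue-edge : ∀ {y z} → (∃ λ i → y ≡ f′ i) → (∃ λ j → z ≡ f′ j) → y ≢ z →
                    Vec.lookup ω (key y z) ≡ blue
        blue-edge (i , refl) (j , refl) y≢z = hom _ _ λ e → y≢z (cong (g ∘ f) e)

    delete : ⊥
    delete = [ no-red , no-blue ]′ (arrows colouring)

-- Growth estimates

bernoulli : ∀ x j → x ^ j * (x + j) ≤ suc x ^ j * x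
bernoulli x zero    = ≤-reflexive (cong (1 *_) (+-identityʳ x))
bernoulli x (suc j) = begin
  x * x ^ j * (x + suc j)           ≤⟨ m≤m+n _ (x ^ j * j) ⟩
  x * x ^ j * (x + suc j) + x ^ j * j ≡⟨ regroup x (x ^ j) j ⟩
  suc x * (x ^ j * (x + j))         ≤⟨ *-monoʳ-≤ (suc x) (bernoulli x j) ⟩
  suc x * (suc x ^ j * x)           ≡⟨ *-assoc (suc x) (suc x ^ j) x ⟨
  suc x * suc x ^ j * x             ∎
  where
  open ≤-Reasoning
  regroup : ∀ x p j → x * p * (x + suc j) + p * j ≡ suc x * (p * (x + j))
  regroup = solve-∀

-- With m = 1 + x this is (1 - 1/m)^m ≤ 1/2: every `m` blue edges cost a factor of two.
2x^m≤m^m : ∀ x → 2 * x ^ suc x ≤ suc x ^ suc x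
2x^m≤m^m zero      = z≤n
2x^m≤m^m x@(suc _) = *-cancelʳ-≤ _ _ x (begin
  2 * x ^ suc x * x            ≡⟨ regroup x (x ^ suc x) ⟩
  x ^ suc x * (x + x)          ≤⟨ *-monoʳ-≤ (x ^ suc x) (+-monoʳ-≤ x (n≤1+n x)) ⟩
  x ^ suc x * (x + suc x)      ≤⟨ bernoulli x (suc x) ⟩
  suc x ^ suc x * x            ∎)
  where
  open ≤-Reasoning
  regroup : ∀ x p → 2 * p * x ≡ p * (x + x)
  regroup = solve-∀

-- (1 - 1 / (1 + h)) ^ i ≥ 1 - i / (1 + h), with r = 1 + h - i.
bernoulli′ : ∀ h i r → i + r ≡ suc h → suc h ^ i * r ≤ h ^ i * suc h
bernoulli′ h zero    r e = *-monoʳ-≤ 1 (≤-reflexive e)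
bernoulli′ h (suc i) r e = begin
  suc h * suc h ^ i * r        ≡⟨ *-rotate (suc h) (suc h ^ i) r ⟩
  suc h ^ i * (r + h * r)      ≤⟨ *-monoʳ-≤ (suc h ^ i) (+-monoˡ-≤ (h * r) (≤-trans (m≤n+m r i) (≤-reflexive (suc-injective e)))) ⟩
  suc h ^ i * (h + h * r)      ≡⟨ *-rotate′ h (suc h ^ i) r ⟩
  h * (suc h ^ i * suc r)      ≤⟨ *-monoʳ-≤ h (bernoulli′ h i (suc r) (trans (+-suc i r) e)) ⟩
  h * (h ^ i * suc h)          ≡⟨ *-assoc h (h ^ i) (suc h) ⟨
  h * h ^ i * suc h            ∎
  where
  open ≤-Reasoning
  *-rotate : ∀ a p r → a * p * r ≡ p * (a * r)
  *-rotate = solve-∀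
  *-rotate′ : ∀ h p r → p * (h + h * r) ≡ h * (p * suc r)
  *-rotate′ = solve-∀

-- A rational stand-in for (1 + 1/h)^h ≤ e. The exponent is halved, whence the even `h`: over `g`
-- factors `bernoulli′` still leaves (g+1)/(2g+1) ≥ 1/2, whereas over all `h` it would leave only
-- 1/(h+1).
1+h^h≤4h^h : ∀ g → suc (g + g) ^ (g + g) ≤ 4 * (g + g) ^ (g + g)
1+h^h≤4h^h g = begin
  suc h ^ (g + g)              ≡⟨ ^-distribˡ-+-* (suc h) g g ⟩
  suc h ^ g * suc h ^ g        ≤⟨ *-mono-≤ half half ⟩
  2 * h ^ g * (2 * h ^ g)      ≡⟨ regroup (h ^ g) ⟩
  4 * (h ^ g * h ^ g)          ≡⟨ cong (4 *_) (^-distribˡ-+-* h g g) ⟨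
  4 * h ^ (g + g)              ∎
  where
  open ≤-Reasoning
  h = g + g
  regroup : ∀ a → 2 * a * (2 * a) ≡ 4 * (a * a)
  regroup = solve-∀
  half : suc h ^ g ≤ 2 * h ^ g
  half = *-cancelʳ-≤ _ _ (suc h) (begin
    suc h ^ g * suc h            ≤⟨ *-monoʳ-≤ (suc h ^ g) (≤-trans (n≤1+n (suc h)) (≤-reflexive (double g))) ⟩
    suc h ^ g * (2 * suc g)      ≡⟨ *.x∙yz≈y∙xz (suc h ^ g) 2 (suc g) ⟩
    2 * (suc h ^ g * suc g)      ≤⟨ *-monoʳ-≤ 2 (bernoulli′ h g (suc g) (+-suc g g)) ⟩
    2 * (h ^ g * suc h)          ≡⟨ *-assoc 2 (h ^ g) (suc h) ⟨
    2 * h ^ g * suc h            ∎)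
    where
    double : ∀ g → suc (suc (g + g)) ≡ 2 * suc g
    double = solve-∀

^-distribʳ-* : ∀ n a b → (a * b) ^ n ≡ a ^ n * b ^ n
^-distribʳ-* zero    a b = refl
^-distribʳ-* (suc n) a b = trans (cong (a * b *_) (^-distribʳ-* n a b)) (*.interchange a b _ _)

-- The bound (eN/s)^s for a binomial coefficient, with 4 for e: `length-choose` is taken at h = N/s,
-- where (1 + 1/h)^N is the s-th power of (1 + 1/h)^h.
length-choose-≤ : ∀ {A : Set} g s (xs : List A) → .{{NonZero g}} → length xs ≡ (g + g) * s →
                  length (choose s xs) ≤ (4 * (g + g)) ^ s
length-choose-≤ g@(suc _) s xs e = *-cancelʳ-≤ _ _ (h ^ (h * s)) {{m^n≢0 h (h * s)}} (begin
  length (choose s xs) * h ^ (h * s)      ≡⟨ cong (λ l → length (choose s xs) * h ^ l) e ⟨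
  length (choose s xs) * h ^ length xs    ≤⟨ length-choose h s xs ⟩
  h ^ s * suc h ^ length xs               ≡⟨ cong (λ l → h ^ s * suc h ^ l) e ⟩
  h ^ s * suc h ^ (h * s)                 ≡⟨ cong (h ^ s *_) (^-*-assoc (suc h) h s) ⟨
  h ^ s * (suc h ^ h) ^ s                 ≤⟨ *-monoʳ-≤ (h ^ s) (^-monoˡ-≤ s (1+h^h≤4h^h g)) ⟩
  h ^ s * (4 * h ^ h) ^ s                 ≡⟨ ^-distribʳ-* s h (4 * h ^ h) ⟨
  (h * (4 * h ^ h)) ^ s                   ≡⟨ cong (_^ s) (regroup h (h ^ h)) ⟩
  (4 * h * h ^ h) ^ s                     ≡⟨ ^-distribʳ-* s (4 * h) (h ^ h) ⟩
  (4 * h) ^ s * (h ^ h) ^ s               ≡⟨ cong ((4 * h) ^ s *_) (^-*-assoc h h s) ⟩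
  (4 * h) ^ s * h ^ (h * s)               ∎)
  where
  open ≤-Reasoning
  h = g + g
  regroup : ∀ h p → h * (4 * p) ≡ 4 * h * p
  regroup = solve-∀

2^n+2^n≡2^1+n : ∀ n → 2 ^ n + 2 ^ n ≡ 2 ^ suc n
2^n+2^n≡2^1+n n = cong (2 ^ n +_) (sym (+-identityʳ _))

n≤2^n : ∀ n → n ≤ 2 ^ n
n≤2^n zero    = z≤n
n≤2^n (suc n) = ≤-trans (+-mono-≤ (m^n>0 2 n) (n≤2^n n)) (≤-reflexive (2^n+2^n≡2^1+n n))

-- At i = 2e one factor 2^e absorbs `c` and the other the linear term; e = c + 5 makes 2e + 15 ≤ 2^e
-- start at 25 ≤ 32. Afterwards the right side doubles at each step and the left at most doubles.
linear≤2^ : ∀ c → ∃ λ i₀ → ∀ i → i₀ ≤ i → c * (i + 7) + 8 ≤ 2 ^ i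
linear≤2^ c = e + e , λ i e+e≤i → subst (λ i → c * (i + 7) + 8 ≤ 2 ^ i) (m∸n+n≡m e+e≤i) (from (i ∸ (e + e)))
  where
  open ≤-Reasoning
  e = c + 5

  2e+15≤2^e : ∀ c → c + 5 + (c + 5) + 15 ≤ 2 ^ (c + 5)
  2e+15≤2^e zero    = m≤m+n 25 7
  2e+15≤2^e (suc c) = begin
    suc c + 5 + (suc c + 5) + 15                   ≤⟨ m≤m+n _ (c + 5 + (c + 5) + 13) ⟩
    suc c + 5 + (suc c + 5) + 15 + (c + 5 + (c + 5) + 13) ≡⟨ regroup c ⟩
    2 * (c + 5 + (c + 5) + 15)                     ≤⟨ *-monoʳ-≤ 2 (2e+15≤2^e c) ⟩
    2 * 2 ^ (c + 5)                                ∎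
    where
    regroup : ∀ c → suc c + 5 + (suc c + 5) + 15 + (c + 5 + (c + 5) + 13) ≡ 2 * (c + 5 + (c + 5) + 15)
    regroup = solve-∀

  from : ∀ d → c * (d + (e + e) + 7) + 8 ≤ 2 ^ (d + (e + e))
  from zero = begin
    c * (e + e + 7) + 8                    ≤⟨ +-mono-≤ (*-monoˡ-≤ (e + e + 7) (≤-trans (m≤m+n c 5) (n≤2^n e)))
                                                       (*-monoˡ-≤ 8 (m^n>0 2 e)) ⟩
    2 ^ e * (e + e + 7) + 2 ^ e * 8        ≡⟨ *-distribˡ-+ (2 ^ e) (e + e + 7) 8 ⟨
    2 ^ e * (e + e + 7 + 8)                ≡⟨ cong (2 ^ e *_) (+-assoc (e + e) 7 8) ⟩
    2 ^ e * (e + e + 15)                   ≤⟨ *-monoʳ-≤ (2 ^ e) (2e+15≤2^e c) ⟩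
    2 ^ e * 2 ^ e                          ≡⟨ ^-distribˡ-+-* 2 e e ⟨
    2 ^ (e + e)                            ∎
  from (suc d) = begin
    c * (suc a + 7) + 8                    ≤⟨ m≤m+n _ (c * (a + 6) + 8) ⟩
    c * (suc a + 7) + 8 + (c * (a + 6) + 8) ≡⟨ regroup c a ⟩
    2 * (c * (a + 7) + 8)                  ≤⟨ *-monoʳ-≤ 2 (from d) ⟩
    2 * 2 ^ a                              ∎
    where
    a = d + (e + e)
    regroup : ∀ c a → c * (suc a + 7) + 8 + (c * (a + 6) + 8) ≡ 2 * (c * (a + 7) + 8)
    regroup = solve-∀

-- Dyadic scales

-- The strict inequality is the lower one because a cut contains only smaller rationals: 2^a must be
-- an element of the cut of `n` to bound its logarithm below.
bracket : ∀ n → 2 ≤ n → ∃ λ a → 2 ^ a < n × n ≤ 2 ^ suc a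
bracket (suc zero) (s≤s ())
bracket (suc (suc zero)) _ = 0 , s≤s (s≤s z≤n) , ≤-refl
bracket (suc n@(suc (suc _))) _ with bracket n (s≤s (s≤s z≤n))
... | a , 2^a<n , n≤2^1+a with suc n ≤? 2 ^ suc a
...   | yes 1+n≤ = a , m<n⇒m<1+n 2^a<n , 1+n≤
...   | no  1+n≰ = suc a , ≰⇒> 1+n≰ , ≤-trans (s≤s n≤2^1+a)
  (≤-trans (+-monoˡ-≤ _ (m^n>0 2 (suc a))) (≤-reflexive (2^n+2^n≡2^1+n (suc a))))

2^-between : ∀ {a b n} → 2 ^ a < n → n ≤ 2 ^ suc b → a ≤ b
2^-between {a} {b} a<n n≤b = ≮⇒≥ λ b<a → <⇒≱ a<n (≤-trans n≤b (^-monoʳ-≤ 2 b<a))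

record Scales (n L M : ℕ) : Set where
  field
    2^L<n   : 2 ^ L < n
    n≤2^1+L : n ≤ 2 ^ suc L
    2^M<L   : 2 ^ M < L
    L≤2^1+M : L ≤ 2 ^ suc M

scales : ∀ M₀ → ∃ λ n₀ → ∀ n → n₀ ≤ n → ∃ λ L → ∃ λ M → Scales n L M × M₀ ≤ M
scales M₀ = suc (2 ^ L₀) , λ n n₀≤n →
  let L , 2^L<n , n≤2^1+L = bracket n (≤-trans (s≤s (m^n>0 2 L₀)) n₀≤n)
      L₀≤L = 2^-between n₀≤n n≤2^1+L
      M , 2^M<L , L≤2^1+M = bracket L (≤-trans (s≤s (m^n>0 2 M₀)) L₀≤L)
  in L , M , record { 2^L<n = 2^L<n ; n≤2^1+L = n≤2^1+L ; 2^M<L = 2^M<L ; L≤2^1+M = L≤2^1+M } ,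
     2^-between L₀≤L L≤2^1+M
  where
  L₀ = suc (2 ^ M₀)

-- Since L + 1 bounds log n from above, this fixes the number 2^(L+M+3) of vertices that must
-- survive.
n[1+L]≤ : ∀ {n L M} → Scales n L M → n * suc L ≤ 2 ^ (L + M + 3)
n[1+L]≤ {n} {L} {M} sc = begin
  n * suc L                     ≤⟨ *-mono-≤ n≤2^1+L (s≤s L≤2^1+M) ⟩
  2 ^ suc L * suc (2 ^ suc M)   ≤⟨ *-monoʳ-≤ (2 ^ suc L) (≤-trans (+-monoˡ-≤ _ (m^n>0 2 (suc M)))
                                     (≤-reflexive (2^n+2^n≡2^1+n (suc M)))) ⟩
  2 ^ suc L * 2 ^ suc (suc M)   ≡⟨ ^-distribˡ-+-* 2 (suc L) (suc (suc M)) ⟨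
  2 ^ (suc L + suc (suc M))     ≡⟨ cong (2 ^_) (regroup L M) ⟩
  2 ^ (L + M + 3)               ∎
  where
  open ≤-Reasoning
  open Scales sc
  regroup : ∀ L M → suc L + suc (suc M) ≡ L + M + 3
  regroup = solve-∀

-- The lower bound in terms of the scales

-- With K = k + 1, the hypothesis leaves a gap of (L+1)/K between Mℓ and L+1. As j ≤ M/(2K), the
-- term jℓ takes at most half of the gap; the other half is at least 1 and pays for passing from L+1
-- to L.
degree-bound : ∀ k L M j ℓ → 2 * suc k * j ≤ M → 2 * suc k ≤ suc L →
               suc k * M * ℓ ≤ k * suc L → (M + j) * ℓ ≤ L
degree-bound k L M j ℓ 2kj≤M 2k≤L kMℓ≤ =
  -- The added 2K² turns the `L` on the right into L+1, the quantity in the hypotheses.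
  *-cancelˡ-≤ (2 * (K * K)) (+-cancelʳ-≤ (2 * (K * K)) _ _ (begin
    2 * (K * K) * ((M + j) * ℓ) + 2 * (K * K)
      ≡⟨ expand K M j ℓ ⟩
    2 * K * (K * M * ℓ) + K * (2 * K * j) * ℓ + 2 * K * K
      ≤⟨ +-mono-≤ (+-monoʳ-≤ (2 * K * (K * M * ℓ)) (*-monoˡ-≤ ℓ (*-monoʳ-≤ K 2kj≤M))) (*-monoˡ-≤ K 2k≤L) ⟩
    2 * K * (K * M * ℓ) + K * M * ℓ + suc L * K
      ≡⟨ collect (K * M * ℓ) K (suc L) ⟩
    (2 * K + 1) * (K * M * ℓ) + suc L * K
      ≤⟨ +-mono-≤ (*-monoʳ-≤ (2 * K + 1) kMℓ≤) (*-monoʳ-≤ (suc L) (n≤1+n K)) ⟩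
    (2 * K + 1) * (k * suc L) + suc L * suc K
      ≡⟨ finish k L ⟩
    2 * (K * K) * L + 2 * (K * K) ∎))
  where
  open ≤-Reasoning
  K = suc k
  expand : ∀ K M j ℓ → 2 * (K * K) * ((M + j) * ℓ) + 2 * (K * K)
           ≡ 2 * K * (K * M * ℓ) + K * (2 * K * j) * ℓ + 2 * K * K
  expand = solve-∀
  collect : ∀ a K l → 2 * K * a + a + l * K ≡ (2 * K + 1) * a + l * K
  collect = solve-∀
  finish : ∀ k L → (2 * suc k + 1) * (k * suc L) + suc L * suc (suc k) ≡ 2 * (suc k * suc k) * L + 2 * (suc k * suc k)
  finish = solve-∀

-- On 2 ^ (L + M + 4) vertices, with red probability 2 ^ -μ and blue cliques of order 2 ^ L.
¬Arrows-dyadic : ∀ μ i M {n ℓ R} (3≤ℓ : 3 ≤ ℓ) → let L = μ + 2 + i in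
  M + 8 ≤ 2 ^ i → (M + (i + 6)) * ℓ ≤ L → 2 ^ L ≤ n → R ≤ 2 ^ (L + M + 3) →
  ¬ Arrows R (cycle ℓ 3≤ℓ) (complete n)
¬Arrows-dyadic μ i M {n} {ℓ} {R} 3≤ℓ M+8≤2^i Dℓ≤L 2^L≤n R≤ =
  ¬Arrows 3≤ℓ x half n q {V} cycles cliques vertices (≤-trans (≤-reflexive half+half) 2^L≤n)
  where
  open ≤-Reasoning
  L = μ + 2 + i
  D = M + (i + 6)
  V = 2 ^ (L + M + 4)
  q = 2 ^ (D * ℓ)
  x = pred (2 ^ μ)
  half = 2 ^ (μ + 1 + i)
  s = half + half
  -- The number of blocks of 2^μ pairs that fit into half², each block contributing a factor 1/2.
  e = 2 ^ L * 2 ^ i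

  half+half : s ≡ 2 ^ L
  half+half = trans (2^n+2^n≡2^1+n (μ + 1 + i)) (cong (2 ^_) (regroup μ i))
    where
    regroup : ∀ μ i → suc (μ + 1 + i) ≡ μ + 2 + i
    regroup = solve-∀

  m≡ : suc x ≡ 2 ^ μ
  m≡ = suc-pred (2 ^ μ) {{m^n≢0 2 μ}}

  cycles : V ^ ℓ ≤ q * suc x ^ ℓ
  cycles = ≤-reflexive (begin-equality
    V ^ ℓ                          ≡⟨ cong (λ a → (2 ^ a) ^ ℓ) (regroup μ i M) ⟩
    (2 ^ (D + μ)) ^ ℓ              ≡⟨ cong (_^ ℓ) (^-distribˡ-+-* 2 D μ) ⟩
    (2 ^ D * 2 ^ μ) ^ ℓ            ≡⟨ ^-distribʳ-* ℓ (2 ^ D) (2 ^ μ) ⟩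
    (2 ^ D) ^ ℓ * (2 ^ μ) ^ ℓ      ≡⟨ cong₂ _*_ (^-*-assoc 2 D ℓ) (cong (_^ ℓ) (sym m≡)) ⟩
    q * suc x ^ ℓ                  ∎)
    where
    regroup : ∀ μ i M → μ + 2 + i + M + 4 ≡ M + (i + 6) + μ
    regroup = solve-∀

  vertices : R + 2 * q ≤ V
  vertices = begin
    R + 2 * q                              ≤⟨ +-mono-≤ R≤ (^-monoʳ-≤ 2 {suc (D * ℓ)} {L + M + 3}
                                                (≤-trans (s≤s (≤-trans Dℓ≤L (m≤m+n L (M + 2)))) (≤-reflexive (regroup L M)))) ⟩
    2 ^ (L + M + 3) + 2 ^ (L + M + 3)      ≡⟨ 2^n+2^n≡2^1+n (L + M + 3) ⟩
    2 ^ suc (L + M + 3)                    ≡⟨ cong (2 ^_) (+-suc (L + M) 3) ⟨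
    V                                      ∎
    where
    regroup : ∀ L M → suc (L + (M + 2)) ≡ L + M + 3
    regroup = solve-∀

  exponent : half * half ≡ suc x * e
  exponent = begin-equality
    half * half                    ≡⟨ ^-distribˡ-+-* 2 (μ + 1 + i) (μ + 1 + i) ⟨
    2 ^ (μ + 1 + i + (μ + 1 + i))  ≡⟨ cong (2 ^_) (regroup μ i) ⟩
    2 ^ (μ + (L + i))              ≡⟨ ^-distribˡ-+-* 2 μ (L + i) ⟩
    2 ^ μ * 2 ^ (L + i)            ≡⟨ cong₂ _*_ (sym m≡) (^-distribˡ-+-* 2 L i) ⟩
    suc x * e                      ∎
    where
    regroup : ∀ μ i → μ + 1 + i + (μ + 1 + i) ≡ μ + (μ + 2 + i + i)
    regroup = solve-∀

  choices : length (choose s (allFin V)) ≤ 2 ^ ((M + 6) * s)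
  choices = begin
    length (choose s (allFin V))   ≤⟨ length-choose-≤ (2 ^ (M + 3)) s (allFin V) {{m^n≢0 2 (M + 3)}} size ⟩
    (4 * (2 ^ (M + 3) + 2 ^ (M + 3))) ^ s  ≡⟨ cong (λ z → (4 * z) ^ s) (2^n+2^n≡2^1+n (M + 3)) ⟩
    (2 ^ 2 * 2 ^ suc (M + 3)) ^ s  ≡⟨ cong (_^ s) (^-distribˡ-+-* 2 2 (suc (M + 3))) ⟨
    (2 ^ (2 + suc (M + 3))) ^ s    ≡⟨ ^-*-assoc 2 (2 + suc (M + 3)) s ⟩
    2 ^ ((2 + suc (M + 3)) * s)    ≡⟨ cong (λ z → 2 ^ (z * s)) (regroup M) ⟩
    2 ^ ((M + 6) * s)              ∎
    where
    regroup : ∀ M → 2 + suc (M + 3) ≡ M + 6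
    regroup = solve-∀
    regroup′ : ∀ L M → L + M + 4 ≡ suc (M + 3) + L
    regroup′ = solve-∀
    size : length (allFin V) ≡ (2 ^ (M + 3) + 2 ^ (M + 3)) * s
    size = begin-equality
      length (allFin V)            ≡⟨ List.length-tabulate {n = V} id ⟩
      2 ^ (L + M + 4)              ≡⟨ cong (2 ^_) (regroup′ L M) ⟩
      2 ^ (suc (M + 3) + L)        ≡⟨ ^-distribˡ-+-* 2 (suc (M + 3)) L ⟩
      2 ^ suc (M + 3) * 2 ^ L      ≡⟨ cong₂ _*_ (sym (2^n+2^n≡2^1+n (M + 3))) (sym half+half) ⟩
      (2 ^ (M + 3) + 2 ^ (M + 3)) * s ∎

  -- The summand 2 is the logarithm of the factor 4 in the union bound, and (M+6)s that of the
  -- number of vertex sets; `s` is at least 1.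
  enough : 2 + (M + 6) * s ≤ e
  enough = begin
    2 + (M + 6) * s                ≤⟨ +-monoˡ-≤ _ (*-monoʳ-≤ 2 (≤-trans (m^n>0 2 L) (≤-reflexive (sym half+half)))) ⟩
    2 * s + (M + 6) * s            ≡⟨ regroup M s ⟩
    s * (M + 8)                    ≤⟨ *-monoʳ-≤ s M+8≤2^i ⟩
    s * 2 ^ i                      ≡⟨ cong (_* 2 ^ i) half+half ⟩
    e                              ∎
    where
    regroup : ∀ M s → 2 * s + (M + 6) * s ≡ s * (M + 8)
    regroup = solve-∀

  cliques : 4 * (length (choose s (allFin V)) * x ^ (half * half)) ≤ suc x ^ (half * half)
  cliques = begin
    4 * (length (choose s (allFin V)) * x ^ (half * half))
      ≤⟨ *-monoʳ-≤ 4 (*-monoˡ-≤ (x ^ (half * half)) choices) ⟩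
    2 ^ 2 * (2 ^ ((M + 6) * s) * x ^ (half * half))
      ≡⟨ *-assoc (2 ^ 2) (2 ^ ((M + 6) * s)) _ ⟨
    2 ^ 2 * 2 ^ ((M + 6) * s) * x ^ (half * half)
      ≡⟨ cong₂ _*_ (^-distribˡ-+-* 2 2 ((M + 6) * s)) (cong (x ^_) (sym exponent)) ⟨
    2 ^ (2 + (M + 6) * s) * x ^ (suc x * e)
      ≤⟨ *-mono-≤ (^-monoʳ-≤ 2 enough) (≤-reflexive (sym (^-*-assoc x (suc x) e))) ⟩
    2 ^ e * (x ^ suc x) ^ e
      ≡⟨ ^-distribʳ-* e 2 (x ^ suc x) ⟨
    (2 * x ^ suc x) ^ e
      ≤⟨ ^-monoˡ-≤ e (2x^m≤m^m x) ⟩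
    (suc x ^ suc x) ^ e
      ≡⟨ ^-*-assoc (suc x) (suc x) e ⟩
    suc x ^ (suc x * e)
      ≡⟨ cong (suc x ^_) exponent ⟨
    suc x ^ (half * half) ∎

-- Bracketing M+8 gives the least admissible `i`, so 2^(i-1) < M+8. Then `linear≤2^` yields 2K(i+6)
-- ≤ M with K = k + 1, its summand 8 cancelling that of M+8.
2^<r : ∀ k → ∃ λ M₀ → ∀ {n L M ℓ} (3≤ℓ : 3 ≤ ℓ) → M₀ ≤ M → Scales n L M →
       suc k * M * ℓ ≤ k * suc L → 2 ^ (L + M + 3) < r (cycle ℓ 3≤ℓ) (complete n)
2^<r k = M₀ , λ {n} {L} {M} 3≤ℓ M₀≤M sc kMℓ≤ →
  let open Scales sc
      j , 2^j<M+8 , M+8≤2^1+j = bracket (M + 8) (≤-trans (m≤n+m 2 6) (m≤n+m 8 M))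
      i = suc j
      i₀≤j = 2^-between (≤-<-trans M₀≤M (m<m+n M z<s)) M+8≤2^1+j
      2k[j+7]≤M = +-cancelʳ-≤ 8 _ _ (≤-trans (large j i₀≤j) (<⇒≤ 2^j<M+8))
      2kj≤M = ≤-trans (≤-reflexive (cong (2 * suc k *_) (sym (+-suc j 6)))) 2k[j+7]≤M
      M≤L = ≤-trans (n≤2^n M) (<⇒≤ 2^M<L)
      i+6≤L = ≤-trans (≤-trans (m≤n*m (i + 6) (2 * suc k)) 2kj≤M) M≤L
      2k≤L = ≤-trans (≤-trans (m≤m*n (2 * suc k) (i + 6)) 2kj≤M) (m≤n⇒m≤1+n M≤L)
      μ = L ∸ (2 + i)
      L≡ : μ + 2 + i ≡ L
      L≡ = trans (+-assoc μ 2 i) (m∸n+n≡m (≤-trans (≤-trans (m≤n+m (2 + i) 4) (≤-reflexive (+-comm 6 i))) i+6≤L))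
  in ≰⇒> λ r≤ → ¬Arrows-dyadic μ i M 3≤ℓ M+8≤2^1+j
       (≤-trans (degree-bound k L M (i + 6) _ 2kj≤M 2k≤L kMℓ≤) (≤-reflexive (sym L≡)))
       (<⇒≤ (subst (λ l → 2 ^ l < n) (sym L≡) 2^L<n))
       (≤-trans r≤ (≤-reflexive (cong (λ l → 2 ^ (l + M + 3)) (sym L≡))))
       (proj₁ (r-isRamseyNumber (cycle _ 3≤ℓ) (complete n)))
  where
  i₀ = proj₁ (linear≤2^ (2 * suc k))
  large = proj₂ (linear≤2^ (2 * suc k))
  M₀ = 2 ^ i₀

-- The embedding of ℕ in ℚ

toℚᵘ-/ : ∀ i d → ℚ.toℚᵘ (i ℚ./ suc d) ℚᵘ.≃ ℚᵘ.mkℚᵘ i d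
toℚᵘ-/ i d = ℚ.toℚᵘ-fromℚᵘ (ℚᵘ.mkℚᵘ i d)

/-mono-≤ : ∀ i j d e → i ℤ.* ℤ.+ suc e ℤ.≤ j ℤ.* ℤ.+ suc d → i ℚ./ suc d ℚ.≤ j ℚ./ suc e
/-mono-≤ i j d e h = ℚ.toℚᵘ-cancel-≤ (ℚᵘ.≤-respˡ-≃ (ℚᵘ.≃-sym (toℚᵘ-/ i d))
  (ℚᵘ.≤-respʳ-≃ (ℚᵘ.≃-sym (toℚᵘ-/ j e)) (ℚᵘ.*≤* h)))

ℕ⇒ℚ-mono-≤ : ∀ {m n} → m ≤ n → ℕ⇒ℚ m ℚ.≤ ℕ⇒ℚ n
ℕ⇒ℚ-mono-≤ {m} {n} m≤n = /-mono-≤ (ℤ.+ m) (ℤ.+ n) 0 0 (ℤ.*-monoʳ-≤-nonNeg (ℤ.+ 1) (ℤ.+≤+ m≤n))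

ℕ⇒ℚ-mono-< : ∀ {m n} → m < n → ℕ⇒ℚ m ℚ.< ℕ⇒ℚ n
ℕ⇒ℚ-mono-< {m} {n} m<n = ℚ.toℚᵘ-cancel-< (ℚᵘ.<-respˡ-≃ (ℚᵘ.≃-sym (toℚᵘ-/ (ℤ.+ m) 0))
  (ℚᵘ.<-respʳ-≃ (ℚᵘ.≃-sym (toℚᵘ-/ (ℤ.+ n) 0)) (ℚᵘ.*<* (ℤ.*-monoʳ-<-pos (ℤ.+ 1) (ℤ.+<+ m<n)))))

ℕ⇒ℚ-* : ∀ m n → ℕ⇒ℚ (m * n) ≡ ℕ⇒ℚ m ℚ.* ℕ⇒ℚ n
ℕ⇒ℚ-* m n = ℚ.toℚᵘ-injective (ℚᵘ.≃-trans (toℚᵘ-/ (ℤ.+ (m * n)) 0) (ℚᵘ.≃-sym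
  (ℚᵘ.≃-trans (ℚ.toℚᵘ-homo-* (ℕ⇒ℚ m) (ℕ⇒ℚ n))
    (ℚᵘ.≃-trans (ℚᵘ.*-cong (toℚᵘ-/ (ℤ.+ m) 0) (toℚᵘ-/ (ℤ.+ n) 0))
      (ℚᵘ.*≡* (cong (ℤ._* ℤ.+ 1) (sym (ℤ.pos-* m n))))))))

ℕ⇒ℚ-suc : ∀ n → ℕ⇒ℚ (suc n) ≡ 1ℚ ℚ.+ ℕ⇒ℚ n
ℕ⇒ℚ-suc n = ℚ.toℚᵘ-injective (ℚᵘ.≃-trans (toℚᵘ-/ (ℤ.+ suc n) 0) (ℚᵘ.≃-sym
  (ℚᵘ.≃-trans (ℚ.toℚᵘ-homo-+ 1ℚ (ℕ⇒ℚ n))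
    (ℚᵘ.≃-trans (ℚᵘ.+-congʳ (ℚ.toℚᵘ 1ℚ) (toℚᵘ-/ (ℤ.+ n) 0))
      (ℚᵘ.*≡* (cong (λ z → ((ℤ.+ 1) ℤ.+ z) ℤ.* ℤ.+ 1) (ℤ.*-identityʳ (ℤ.+ n))))))))

ℕ⇒ℚ-^ : ∀ m n → ℕ⇒ℚ (m ^ n) ≡ ℕ⇒ℚ m ^ℚ n
ℕ⇒ℚ-^ m zero    = refl
ℕ⇒ℚ-^ m (suc n) = trans (ℕ⇒ℚ-* m (m ^ n)) (cong (ℕ⇒ℚ m ℚ.*_) (ℕ⇒ℚ-^ m n))

0≤ℕ⇒ℚ : ∀ n → 0ℚ ℚ.≤ ℕ⇒ℚ n
0≤ℕ⇒ℚ n = ℕ⇒ℚ-mono-≤ {0} {n} z≤n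

0<ℕ⇒ℚ : ∀ {n} → 0 < n → 0ℚ ℚ.< ℕ⇒ℚ n
0<ℕ⇒ℚ = ℕ⇒ℚ-mono-< {0}

reciprocal : ∀ n → 0 < n → ∃ λ u → 0ℚ ℚ.< u × u ℚ.* ℕ⇒ℚ n ≡ 1ℚ
reciprocal n 0<n = ℚ.1/ ℕ⇒ℚ n , ℚ.positive⁻¹ _ {{ℚ.1/pos⇒pos (ℕ⇒ℚ n)}} , ℚ.*-inverseˡ (ℕ⇒ℚ n)
  where instance
    >0 = ℚ.positive (0<ℕ⇒ℚ 0<n)
    ≢0 = ℚ.pos⇒nonZero (ℕ⇒ℚ n)

*-monoˡ-≤ℚ : ∀ {t p q} → 0ℚ ℚ.≤ t → p ℚ.≤ q → p ℚ.* t ℚ.≤ q ℚ.* t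
*-monoˡ-≤ℚ {t} 0≤t = ℚ.*-monoʳ-≤-nonNeg t {{ℚ.nonNegative 0≤t}}

*-monoʳ-≤ℚ : ∀ {t p q} → 0ℚ ℚ.≤ t → p ℚ.≤ q → t ℚ.* p ℚ.≤ t ℚ.* q
*-monoʳ-≤ℚ {t} 0≤t = ℚ.*-monoˡ-≤-nonNeg t {{ℚ.nonNegative 0≤t}}

*-mono-≤ℚ : ∀ {p p′ q q′} → 0ℚ ℚ.≤ p → 0ℚ ℚ.≤ q → p ℚ.≤ p′ → q ℚ.≤ q′ → p ℚ.* q ℚ.≤ p′ ℚ.* q′
*-mono-≤ℚ 0≤p 0≤q p≤p′ q≤q′ =
  ℚ.≤-trans (*-monoˡ-≤ℚ 0≤q p≤p′) (*-monoʳ-≤ℚ (ℚ.≤-trans 0≤p p≤p′) q≤q′)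

*-cancelʳ-<ℚ : ∀ {p q} r → 0ℚ ℚ.≤ r → p ℚ.* r ℚ.< q ℚ.* r → p ℚ.< q
*-cancelʳ-<ℚ r 0≤r = ℚ.*-cancelʳ-<-nonNeg r {{ℚ.nonNegative 0≤r}}

*-cancelʳ-≡ℚ : ∀ {p q} r → 0ℚ ℚ.< r → p ℚ.* r ≡ q ℚ.* r → p ≡ q
*-cancelʳ-≡ℚ r 0<r e = ℚ.≤-antisym (cancel (ℚ.≤-reflexive e)) (cancel (ℚ.≤-reflexive (sym e)))
  where
  cancel : ∀ {p q} → p ℚ.* r ℚ.≤ q ℚ.* r → p ℚ.≤ q
  cancel = ℚ.*-cancelʳ-≤-pos r {{ℚ.positive 0<r}}

0≤^ℚ : ∀ {p} n → 0ℚ ℚ.≤ p → 0ℚ ℚ.≤ p ^ℚ n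
0≤^ℚ zero    0≤p = 0≤ℕ⇒ℚ 1
0≤^ℚ (suc n) 0≤p = *-mono-≤ℚ ℚ.≤-refl ℚ.≤-refl 0≤p (0≤^ℚ n 0≤p)

^ℚ-monoˡ-≤ : ∀ {p q} n → 0ℚ ℚ.≤ p → p ℚ.≤ q → p ^ℚ n ℚ.≤ q ^ℚ n
^ℚ-monoˡ-≤ zero    0≤p p≤q = ℚ.≤-refl
^ℚ-monoˡ-≤ (suc n) 0≤p p≤q = *-mono-≤ℚ 0≤p (0≤^ℚ n 0≤p) p≤q (^ℚ-monoˡ-≤ n 0≤p p≤q)

-- For q = (1+a)/(1+d), already 1/(1+d) ≤ q; the next unit fraction makes this strict.
archimedean : ∀ q → 0ℚ ℚ.< q → ∃ λ k → ∃ λ u → 0ℚ ℚ.< u × u ℚ.* ℕ⇒ℚ (suc k) ≡ 1ℚ × u ℚ.< q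
archimedean (mkℚ (ℤ.+ 0) d _) (ℚ.*<* (ℤ.+<+ ()))
archimedean (mkℚ -[1+ _ ] d _) (ℚ.*<* ())
archimedean q@(mkℚ +[1+ a ] d _) 0<q with reciprocal (suc (suc d)) z<s
... | u , 0<u , uk≡1 = suc d , u , 0<u , uk≡1 , *-cancelʳ-<ℚ (ℕ⇒ℚ (suc (suc d))) (0≤ℕ⇒ℚ (suc (suc d))) (begin-strict
  u ℚ.* ℕ⇒ℚ (suc (suc d))   ≡⟨ uk≡1 ⟩
  1ℚ                        ≤⟨ 1≤q[1+d] ⟩
  q ℚ.* ℕ⇒ℚ (suc d)         <⟨ ℚ.*-monoʳ-<-pos q {{ℚ.positive 0<q}} (ℕ⇒ℚ-mono-< (n<1+n (suc d))) ⟩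
  q ℚ.* ℕ⇒ℚ (suc (suc d))   ∎)
  where
  open ℚ.≤-Reasoning
  1≤q[1+d] : 1ℚ ℚ.≤ q ℚ.* ℕ⇒ℚ (suc d)
  1≤q[1+d] = ℚ.toℚᵘ-cancel-≤ (ℚᵘ.≤-respʳ-≃ (ℚᵘ.≃-sym (ℚᵘ.≃-trans (ℚ.toℚᵘ-homo-* q (ℕ⇒ℚ (suc d)))
    (ℚᵘ.*-congˡ (toℚᵘ-/ (ℤ.+ suc d) 0)))) (ℚᵘ.*≤* (ℤ.+≤+ (≤-trans (m≤m+n _ (a * suc d)) (≤-reflexive (regroup a d))))))
    where
    regroup : ∀ a d → 1 * (suc d * 1) + a * suc d ≡ suc a * suc d * 1
    regroup = solve-∀

-- Bounds for cuts

∋-∌⇒< : ∀ x {p q} → x ∋ p → ¬ (x ∋ q) → p ℚ.< q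
∋-∌⇒< x {p} {q} xp ¬xq with ℚ.<-cmp p q
... | tri< p<q _ _ = p<q
... | tri≈ _ refl _ = contradiction xp ¬xq
... | tri> _ _ q<p = contradiction (ℝ.lower x q<p xp) ¬xq

∋-≺⇒< : ∀ x {p q} → x ∋ p → x ≺ q → p ℚ.< q
∋-≺⇒< x xp (r , r<q , ¬xr) = ℚ.<-trans (∋-∌⇒< x xp ¬xr) r<q

∋-≤ : ∀ x {p q} → p ℚ.≤ q → x ∋ q → x ∋ p
∋-≤ x {p} {q} p≤q xq with ℚ.<-cmp p q
... | tri< p<q _ _ = ℝ.lower x p<q xq
... | tri≈ _ refl _ = xq
... | tri> _ _ q<p = contradiction (ℚ.<-≤-trans q<p p≤q) (ℚ.<-irrefl refl)

0<ᴿ⇒∋0 : ∀ {x} → 0ᴿ <ᴿ x → x ∋ 0ℚ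
0<ᴿ⇒∋0 {x} (q , q≮0 , xq) = ∋-≤ x (ℚ.≮⇒≥ q≮0) xq

≺-above : ∀ x → ∃ λ q → x ≺ q
≺-above x = let q , ¬xq = ℝ.bounded x in
  q ℚ.+ 1ℚ , q , subst (ℚ._< q ℚ.+ 1ℚ) (ℚ.+-identityʳ q) (ℚ.+-monoʳ-< q (0<ℕ⇒ℚ {1} z<s)) , ¬xq

corner≤ : ∀ a a′ {b b′ t} → b ℚ.≤ t → t ℚ.≤ b′ → corner a a′ b b′ ℚ.≤ a ℚ.* t
corner≤ a a′ {b} {b′} b≤t t≤b′ = ℚ.≤-trans (ℚ.p⊓q≤p ((a ℚ.* b) ℚ.⊓ (a ℚ.* b′)) ((a′ ℚ.* b) ℚ.⊓ (a′ ℚ.* b′))) (by-sign (ℚ.≤-total 0ℚ a))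
  where
  by-sign : 0ℚ ℚ.≤ a ⊎ a ℚ.≤ 0ℚ → _
  by-sign (inj₁ 0≤a) = ℚ.≤-trans (ℚ.p⊓q≤p (a ℚ.* b) (a ℚ.* b′)) (*-monoʳ-≤ℚ 0≤a b≤t)
  by-sign (inj₂ a≤0) = ℚ.≤-trans (ℚ.p⊓q≤q (a ℚ.* b) (a ℚ.* b′))
    (ℚ.*-monoˡ-≤-nonPos a {{ℚ.nonPositive a≤0}} t≤b′)

-- Only `y` is assumed positive, since the factor 1-ε may be negative. Raising `b` to b ⊔ 0 stays
-- within [b, b′] and below `q`, and makes multiplication by it monotone.
*ᴿ-upper : ∀ x y {p q} → y ∋ 0ℚ → 0ℚ ℚ.≤ p → ¬ (x ∋ p) → ¬ (y ∋ q) → ¬ (x *ᴿ y ∋ p ℚ.* q)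
*ᴿ-upper x y {p} {q} y0 0≤p ¬xp ¬yq (_ , (a , a′ , b , b′ , (xa , _) , (yb , yb′) , refl) , pq<) =
  ℚ.<-irrefl refl (begin-strict
    p ℚ.* q             <⟨ pq< ⟩
    corner a a′ b b′    ≤⟨ corner≤ a a′ (ℚ.p≤p⊔q b 0ℚ) (ℚ.⊔-lub (ℚ.<⇒≤ (∋-≺⇒< y yb yb′)) (ℚ.<⇒≤ (∋-≺⇒< y y0 yb′))) ⟩
    a ℚ.* t             ≤⟨ *-monoˡ-≤ℚ (ℚ.p≤q⊔p b 0ℚ) (ℚ.<⇒≤ (∋-∌⇒< x xa ¬xp)) ⟩
    p ℚ.* t             ≤⟨ *-monoʳ-≤ℚ 0≤p (ℚ.⊔-lub (ℚ.<⇒≤ (∋-∌⇒< y yb ¬yq)) (ℚ.<⇒≤ (∋-∌⇒< y y0 ¬yq))) ⟩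
    p ℚ.* q             ∎)
  where
  open ℚ.≤-Reasoning
  t = b ℚ.⊔ 0ℚ

*ᴿ-lower : ∀ x y {p q z} → 0ℚ ℚ.≤ p → 0ℚ ℚ.≤ q → x ∋ p → y ∋ q → z ℚ.< p ℚ.* q → x *ᴿ y ∋ z
*ᴿ-lower x y {p} {q} 0≤p 0≤q xp yq z<pq =
  let p′ , xp′ = ≺-above x
      q′ , yq′ = ≺-above y
      p≤p′ = ℚ.<⇒≤ (∋-≺⇒< x xp xp′)
      q≤q′ = ℚ.<⇒≤ (∋-≺⇒< y yq yq′)
  in corner p p′ q q′ , (p , p′ , q , q′ , (xp , xp′) , (yq , yq′) , refl) ,
     ℚ.<-≤-trans z<pq (ℚ.⊓-glb
       (ℚ.⊓-glb ℚ.≤-refl (*-monoʳ-≤ℚ 0≤p q≤q′))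
       (ℚ.⊓-glb (*-monoˡ-≤ℚ 0≤q p≤p′) (*-mono-≤ℚ 0≤p 0≤q p≤p′ q≤q′)))

recip-upper : ∀ y 0<y {b s} → 0ℚ ℚ.< s → s ℚ.* b ≡ 1ℚ → ℚ⇒ℝ b ≤ᴿ y → ¬ (recip y 0<y ∋ s)
recip-upper y 0<y {b} {s} 0<s sb≡1 b≤y (s′ , (b′ , (p , p<b′ , ¬yp) , s′b′≡1) , s<s′) =
  ℚ.<-irrefl refl (begin-strict
    1ℚ           ≡⟨ sb≡1 ⟨
    s ℚ.* b      <⟨ ℚ.*-monoʳ-<-pos s {{ℚ.positive 0<s}} b<b′ ⟩
    s ℚ.* b′     ≤⟨ *-monoˡ-≤ℚ 0≤b′ (ℚ.<⇒≤ s<s′) ⟩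
    s′ ℚ.* b′    ≡⟨ s′b′≡1 ⟩
    1ℚ           ∎)
  where
  open ℚ.≤-Reasoning
  b<b′ = ℚ.≤-<-trans (ℚ.≮⇒≥ λ p<b → ¬yp (b≤y p p<b)) p<b′
  0≤b′ = ℚ.<⇒≤ (∋-≺⇒< y (0<ᴿ⇒∋0 {y} 0<y) (p , p<b′ , ¬yp))

recip∋0 : ∀ y 0<y → recip y 0<y ∋ 0ℚ
recip∋0 y 0<y = ℚ.1/ b , (b , yb , ℚ.*-inverseˡ b) , ℚ.positive⁻¹ _ {{ℚ.1/pos⇒pos b}}
  where
  b = proj₁ (≺-above y)
  yb = proj₂ (≺-above y)
  instance
    >0 = ℚ.positive (∋-≺⇒< y (0<ᴿ⇒∋0 {y} 0<y) yb)
    ≢0 = ℚ.pos⇒nonZero b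

/ᴿ∋0 : ∀ x y 0<x 0<y → x /ᴿ y [ 0<y ] ∋ 0ℚ
/ᴿ∋0 x y 0<x 0<y = 0<ᴿ⇒∋0 {x /ᴿ y [ 0<y ]}
  (*ᴿ-pos {x} {recip y 0<y} 0<x (0ℚ , ℚ.<-irrefl refl , recip∋0 y 0<y))

log₂-upper : ∀ x 0<x k → ¬ (x ∋ ℕ⇒ℚ (2 ^ k)) → ¬ (log₂ x 0<x ∋ ℕ⇒ℚ k)
log₂-upper x 0<x k ¬x2^k (_ , (-[1+ n ] , b , _ , _ , _ , _ , refl) , k<) =
  ℚ.<-irrefl refl (ℚ.<-≤-trans k< (/-mono-≤ -[1+ n ] (ℤ.+ k) b 0 (ℤ.≤-trans (ℤ.≤-reflexive (ℤ.*-identityʳ -[1+ n ]))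
    (ℤ.≤-trans ℤ.-≤+ (ℤ.≤-reflexive (ℤ.pos-* k (suc b)))))))
log₂-upper x 0<x k ¬x2^k (_ , (ℤ.+ n , b , r , xr , 0<r , 2^n<r^b , refl) , k<) with n ≤? k * suc b
... | yes n≤kb = ℚ.<-irrefl refl (ℚ.<-≤-trans k< (/-mono-≤ (ℤ.+ n) (ℤ.+ k) b 0 (ℤ.≤-trans (ℤ.≤-reflexive (ℤ.*-identityʳ (ℤ.+ n)))
    (ℤ.≤-trans (ℤ.+≤+ n≤kb) (ℤ.≤-reflexive (ℤ.pos-* k (suc b)))))))
... | no n≰kb = ℚ.<-irrefl refl (begin-strict
  ℕ⇒ℚ 2 ^ℚ n                      <⟨ 2^n<r^b ⟩
  r ^ℚ suc b                      ≤⟨ ^ℚ-monoˡ-≤ (suc b) (ℚ.<⇒≤ 0<r) (ℚ.<⇒≤ (∋-∌⇒< x xr ¬x2^k)) ⟩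
  ℕ⇒ℚ (2 ^ k) ^ℚ suc b            ≡⟨ ℕ⇒ℚ-^ (2 ^ k) (suc b) ⟨
  ℕ⇒ℚ ((2 ^ k) ^ suc b)           ≡⟨ cong ℕ⇒ℚ (^-*-assoc 2 k (suc b)) ⟩
  ℕ⇒ℚ (2 ^ (k * suc b))           ≤⟨ ℕ⇒ℚ-mono-≤ (^-monoʳ-≤ 2 (<⇒≤ (≰⇒> n≰kb))) ⟩
  ℕ⇒ℚ (2 ^ n)                     ≡⟨ ℕ⇒ℚ-^ 2 n ⟩
  ℕ⇒ℚ 2 ^ℚ n                      ∎)
  where open ℚ.≤-Reasoning

log₂-lower : ∀ x 0<x k → x ∋ ℕ⇒ℚ (2 ^ k) → ℕ⇒ℝ k ≤ᴿ log₂ x 0<x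
log₂-lower x 0<x k x2^k q q<k =
  let r , 2^k<r , xr = ℝ.open′ x x2^k in
  ℕ⇒ℚ k , (ℤ.+ k , 0 , r , xr , ℚ.≤-<-trans (0≤ℕ⇒ℚ (2 ^ k)) 2^k<r ,
    subst₂ ℚ._<_ (ℕ⇒ℚ-^ 2 k) (sym (ℚ.*-identityʳ r)) 2^k<r , refl) , q<k

1-ᴿ-upper : ∀ ε u → ε ∋ u → ¬ (1ᴿ -ᴿ ε ∋ 1ℚ ℚ.- u)
1-ᴿ-upper ε u εu (_ , (a , b , a<1 , εb , refl) , 1-u<a-b) =
  ℚ.<-asym 1-u<a-b (ℚ.+-mono-< a<1 (ℚ.neg-antimono-< (∋-≺⇒< ε εu εb)))

-- Logarithms and the ratio at a given scale

module _ {n L M : ℕ} (sc : Scales n L M) (3≤n : 3 ≤ n) where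

  open Scales sc

  private
    log′ = log n 3≤n
    loglog′ = loglog n 3≤n

  log-upper : ¬ (log′ ∋ ℕ⇒ℚ (suc L))
  log-upper = log₂-upper (ℕ⇒ℝ n) (ℕ⇒ℝ-pos 3≤n) (suc L) λ 2^1+L<n →
    ℚ.<-irrefl refl (ℚ.<-≤-trans 2^1+L<n (ℕ⇒ℚ-mono-≤ n≤2^1+L))

  log-lower : ℕ⇒ℝ L ≤ᴿ log′
  log-lower = log₂-lower (ℕ⇒ℝ n) (ℕ⇒ℝ-pos 3≤n) L (ℕ⇒ℚ-mono-< 2^L<n)

  loglog-lower : ℕ⇒ℝ M ≤ᴿ loglog′
  loglog-lower = log₂-lower log′ (log-pos 3≤n) M (log-lower _ (ℕ⇒ℚ-mono-< 2^M<L))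

  nlogn-upper : ¬ (nlogn n 3≤n ∋ ℕ⇒ℚ n ℚ.* ℕ⇒ℚ (suc L))
  nlogn-upper = *ᴿ-upper (ℕ⇒ℝ n) log′ (0<ᴿ⇒∋0 {log′} (log-pos 3≤n)) (0≤ℕ⇒ℚ n) (ℚ.<-irrefl refl) log-upper

  -- Here 1-u = k/(k+1) exceeds 1-ε, so (1-u)(L+1)/M is not in the cut bounding ℓ. If the conclusion
  -- failed, this rational would lie below ℓ and hence in that cut.
  InRange⇒≤ : ∀ ε k {u ℓ} → u ℚ.* ℕ⇒ℚ (suc k) ≡ 1ℚ → ε ∋ u → 0 < M →
              InRange ε n 3≤n ℓ → suc k * M * ℓ ≤ k * suc L
  InRange⇒≤ ε k {u} {ℓ} uK≡1 εu 0<M inRange = bound (reciprocal M 0<M)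
    where
    K = ℕ⇒ℚ (suc k)
    e = 1ℚ ℚ.- u

    eK≡k : e ℚ.* K ≡ ℕ⇒ℚ k
    eK≡k = begin
      e ℚ.* K                    ≡⟨ solve 2 (λ u K → (con 1ℚ :- u) :* K := K :- u :* K) refl u K ⟩
      K ℚ.- u ℚ.* K              ≡⟨ cong₂ ℚ._-_ (ℕ⇒ℚ-suc k) uK≡1 ⟩
      1ℚ ℚ.+ ℕ⇒ℚ k ℚ.- 1ℚ        ≡⟨ solve 1 (λ k → con 1ℚ :+ k :- con 1ℚ := k) refl (ℕ⇒ℚ k) ⟩
      ℕ⇒ℚ k                      ∎
      where
      open ≡-Reasoning
      open +-*-Solver

    0≤e : 0ℚ ℚ.≤ e
    0≤e = ℚ.*-cancelʳ-≤-pos K {{ℚ.positive (0<ℕ⇒ℚ {suc k} z<s)}}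
      (subst₂ ℚ._≤_ (sym (ℚ.*-zeroˡ K)) (sym eK≡k) (0≤ℕ⇒ℚ k))

    bound : (∃ λ v → 0ℚ ℚ.< v × v ℚ.* ℕ⇒ℚ M ≡ 1ℚ) → suc k * M * ℓ ≤ k * suc L
    bound (v , 0<v , vM≡1) = ≮⇒≥ λ lt →
      *ᴿ-upper (1ᴿ -ᴿ ε) (log′ /ᴿ loglog′ [ loglog-pos 3≤n ])
        (/ᴿ∋0 log′ loglog′ (log-pos 3≤n) (loglog-pos 3≤n)) 0≤e (1-ᴿ-upper ε u εu)
        (*ᴿ-upper log′ (recip loglog′ (loglog-pos 3≤n)) (recip∋0 loglog′ (loglog-pos 3≤n))
          (0≤ℕ⇒ℚ (suc L)) log-upper (recip-upper loglog′ (loglog-pos 3≤n) 0<v vM≡1 loglog-lower))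
        (inRange _ (below lt))
      where
      below : k * suc L < suc k * M * ℓ → e ℚ.* (ℕ⇒ℚ (suc L) ℚ.* v) ℚ.< ℕ⇒ℚ ℓ
      below lt = *-cancelʳ-<ℚ (ℕ⇒ℚ (suc k * M)) (0≤ℕ⇒ℚ (suc k * M)) (begin-strict
        e ℚ.* (ℕ⇒ℚ (suc L) ℚ.* v) ℚ.* ℕ⇒ℚ (suc k * M)
          ≡⟨ cong (e ℚ.* (ℕ⇒ℚ (suc L) ℚ.* v) ℚ.*_) (ℕ⇒ℚ-* (suc k) M) ⟩
        e ℚ.* (ℕ⇒ℚ (suc L) ℚ.* v) ℚ.* (K ℚ.* ℕ⇒ℚ M)
          ≡⟨ solve 5 (λ e l v K M → e :* (l :* v) :* (K :* M) := (e :* K) :* l :* (v :* M)) refl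
               e (ℕ⇒ℚ (suc L)) v K (ℕ⇒ℚ M) ⟩
        e ℚ.* K ℚ.* ℕ⇒ℚ (suc L) ℚ.* (v ℚ.* ℕ⇒ℚ M)
          ≡⟨ cong₂ (λ a b → a ℚ.* ℕ⇒ℚ (suc L) ℚ.* b) eK≡k vM≡1 ⟩
        ℕ⇒ℚ k ℚ.* ℕ⇒ℚ (suc L) ℚ.* 1ℚ
          ≡⟨ trans (ℚ.*-identityʳ _) (sym (ℕ⇒ℚ-* k (suc L))) ⟩
        ℕ⇒ℚ (k * suc L)
          <⟨ ℕ⇒ℚ-mono-< lt ⟩
        ℕ⇒ℚ (suc k * M * ℓ)
          ≡⟨ trans (cong ℕ⇒ℚ (*-comm (suc k * M) ℓ)) (ℕ⇒ℚ-* ℓ (suc k * M)) ⟩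
        ℕ⇒ℚ ℓ ℚ.* ℕ⇒ℚ (suc k * M) ∎)
        where
        open ℚ.≤-Reasoning
        open +-*-Solver

  -- The numerator is at most ℓ(n-1), and 2Kℓ ≤ Mℓ ≤ L+1 with K = k + 1. The factor 2 leaves room to
  -- beat L-1 instead of L.
  ratio-upper : ∀ k {u ℓ} → 0ℚ ℚ.< u → u ℚ.* ℕ⇒ℚ (suc k) ≡ 1ℚ → 2 * suc k ≤ M → 1 ≤ ℓ → M * ℓ ≤ suc L →
                ¬ (ratio ℓ n 3≤n ∋ u)
  ratio-upper k {u} {ℓ} 0<u uK≡1 2K≤M 1≤ℓ Mℓ≤ ratio∋u =
    *ᴿ-upper (ℕ⇒ℝ P) (recip nlogn′ (nlogn-pos 3≤n)) (recip∋0 nlogn′ (nlogn-pos 3≤n))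
      (0≤ℕ⇒ℚ P) (ℚ.<-irrefl refl)
      (recip-upper nlogn′ (nlogn-pos 3≤n) {s = w} 0<w wKP≡1 λ q q<KP → ℝ.lower nlogn′ q<KP nlogn∋KP)
      (subst (ratio ℓ n 3≤n ∋_) u≡Pw ratio∋u)
    where
    nlogn′ = nlogn n 3≤n
    K = suc k
    P = (ℓ ∸ 1) * (n ∸ 1) + 1

    0<KP : 0 < K * P
    0<KP = ≤-trans (m≤n+m 1 ((ℓ ∸ 1) * (n ∸ 1))) (m≤n*m P K)

    w = proj₁ (reciprocal (K * P) 0<KP)
    0<w = proj₁ (proj₂ (reciprocal (K * P) 0<KP))
    wKP≡1 = proj₂ (proj₂ (reciprocal (K * P) 0<KP))

    -- Writing 1/K as P times 1/(KP) matches the shape of the ratio, numerator times reciprocal, so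
    -- that `*ᴿ-upper` applies factor by factor.
    u≡Pw : u ≡ ℕ⇒ℚ P ℚ.* w
    u≡Pw = *-cancelʳ-≡ℚ (ℕ⇒ℚ K) (0<ℕ⇒ℚ {K} z<s) (begin
      u ℚ.* ℕ⇒ℚ K                  ≡⟨ trans uK≡1 (sym wKP≡1) ⟩
      w ℚ.* ℕ⇒ℚ (K * P)            ≡⟨ cong (w ℚ.*_) (ℕ⇒ℚ-* K P) ⟩
      w ℚ.* (ℕ⇒ℚ K ℚ.* ℕ⇒ℚ P)      ≡⟨ solve 3 (λ w K P → w :* (K :* P) := P :* w :* K) refl w (ℕ⇒ℚ K) (ℕ⇒ℚ P) ⟩
      ℕ⇒ℚ P ℚ.* w ℚ.* ℕ⇒ℚ K        ∎)
      where
      open ≡-Reasoning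
      open +-*-Solver

    P≤ : P ≤ ℓ * (n ∸ 1)
    P≤ = begin
      (ℓ ∸ 1) * (n ∸ 1) + 1         ≤⟨ +-monoʳ-≤ _ (∸-monoˡ-≤ 1 (≤-trans (n≤1+n 2) 3≤n)) ⟩
      (ℓ ∸ 1) * (n ∸ 1) + (n ∸ 1)   ≡⟨ +-comm _ (n ∸ 1) ⟩
      suc (ℓ ∸ 1) * (n ∸ 1)         ≡⟨ cong (_* (n ∸ 1)) (m+[n∸m]≡n 1≤ℓ) ⟩
      ℓ * (n ∸ 1)                   ∎
      where open ≤-Reasoning

    4<L : 4 < L
    4<L = ≤-<-trans (^-monoʳ-≤ 2 (≤-trans (m≤m*n 2 K) 2K≤M)) 2^M<L

    Kℓ<L∸1 : K * ℓ < L ∸ 1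
    Kℓ<L∸1 = *-cancelˡ-< 2 _ _ (begin-strict
      2 * (K * ℓ)     ≡⟨ *-assoc 2 K ℓ ⟨
      2 * K * ℓ       ≤⟨ *-monoˡ-≤ ℓ 2K≤M ⟩
      M * ℓ           ≤⟨ Mℓ≤ ⟩
      suc L           <⟨ slack 4<L ⟩
      2 * (L ∸ 1)     ∎)
      where
      open ≤-Reasoning
      slack : ∀ {L} → 4 < L → suc L < 2 * (L ∸ 1)
      slack (s≤s {n = l} 4≤l) = ≤-trans (≤-reflexive (+-comm 3 l))
        (+-monoʳ-≤ l (≤-trans (≤-trans (n≤1+n 3) 4≤l) (≤-reflexive (sym (+-identityʳ l)))))

    n∸1<n : n ∸ 1 < n
    n∸1<n = ≤-reflexive (m+[n∸m]≡n (≤-trans (s≤s z≤n) 3≤n))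

    L∸1<L : L ∸ 1 < L
    L∸1<L = ≤-reflexive (m+[n∸m]≡n (≤-trans (s≤s z≤n) 4<L))

    KP< : K * P < (n ∸ 1) * (L ∸ 1)
    KP< = begin-strict
      K * P                   ≤⟨ *-monoʳ-≤ K P≤ ⟩
      K * (ℓ * (n ∸ 1))       ≡⟨ trans (sym (*-assoc K ℓ (n ∸ 1))) (*-comm (K * ℓ) (n ∸ 1)) ⟩
      (n ∸ 1) * (K * ℓ)       <⟨ *-monoʳ-< (n ∸ 1) {{>-nonZero (∸-monoˡ-≤ 1 (≤-trans (n≤1+n 2) 3≤n))}} Kℓ<L∸1 ⟩
      (n ∸ 1) * (L ∸ 1)       ∎
      where open ≤-Reasoning

    -- Cuts are open, so n-1 and L-1 serve as elements of the cuts of n and log n.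
    nlogn∋KP : nlogn′ ∋ ℕ⇒ℚ (K * P)
    nlogn∋KP = *ᴿ-lower (ℕ⇒ℝ n) log′ (0≤ℕ⇒ℚ (n ∸ 1)) (0≤ℕ⇒ℚ (L ∸ 1))
      (ℕ⇒ℚ-mono-< n∸1<n) (log-lower _ (ℕ⇒ℚ-mono-< L∸1<L))
      (subst (ℕ⇒ℚ (K * P) ℚ.<_) (ℕ⇒ℚ-* (n ∸ 1) (L ∸ 1)) (ℕ⇒ℚ-mono-< KP<))

-- Unit fractions below ε and δ, and the two claims

UnitFraction : ℝ → Set
UnitFraction x = ∃ λ k → ∃ λ u → 0ℚ ℚ.< u × u ℚ.* ℕ⇒ℚ (suc k) ≡ 1ℚ × x ∋ u

unitFraction : ∀ x → 0ᴿ <ᴿ x → UnitFraction x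
unitFraction x 0<x =
  let q , 0<q , xq = ℝ.open′ x (0<ᴿ⇒∋0 {x} 0<x)
      k , u , 0<u , uk≡1 , u<q = archimedean q 0<q
  in k , u , 0<u , uk≡1 , ℝ.lower x u<q xq

theorem1p2 : (ε : ℝ) → 0ᴿ <ᴿ ε →
    (∃ λ (n₀ : ℕ) → (n : ℕ) → n₀ ≤ n → (3≤n : 3 ≤ n) →
    (ℓ : ℕ) → (3≤ℓ : 3 ≤ ℓ) → InRange ε n 3≤n ℓ →
    ℕ⇒ℝ (r (cycle ℓ 3≤ℓ) (complete n)) >ᴿ nlogn n 3≤n)
    ×
    ((δ : ℝ) → 0ᴿ <ᴿ δ →
    ∃ λ (n₁ : ℕ) → (n : ℕ) → n₁ ≤ n → (3≤n : 3 ≤ n) →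
    (ℓ : ℕ) → 3 ≤ ℓ → InRange ε n 3≤n ℓ →
    ratio ℓ n 3≤n <ᴿ δ)
theorem1p2 ε 0<ε = lowerBound (unitFraction ε 0<ε) , λ δ 0<δ → vanishing δ (unitFraction ε 0<ε) (unitFraction δ 0<δ)
  where
  lowerBound : UnitFraction ε → ∃ λ n₀ → ∀ n → n₀ ≤ n → (3≤n : 3 ≤ n) → ∀ ℓ → (3≤ℓ : 3 ≤ ℓ) →
    InRange ε n 3≤n ℓ → ℕ⇒ℝ (r (cycle ℓ 3≤ℓ) (complete n)) >ᴿ nlogn n 3≤n
  lowerBound (k , u , _ , uk≡1 , εu) = n₀ , λ n n₀≤n 3≤n ℓ 3≤ℓ inRange →
    let L , M , sc , 1+M₀≤M = large n n₀≤n
        2^<r′ = bound 3≤ℓ (≤-trans (n≤1+n M₀) 1+M₀≤M) sc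
                  (InRange⇒≤ sc 3≤n ε k {u} {ℓ} uk≡1 εu (≤-trans (s≤s z≤n) 1+M₀≤M) inRange)
    -- The separating rational is n(L+1), which is at least n log n and at most 2^(L+M+3).
    in ℕ⇒ℚ n ℚ.* ℕ⇒ℚ (suc L) , nlogn-upper sc 3≤n ,
       subst (ℚ._< ℕ⇒ℚ (r (cycle ℓ 3≤ℓ) (complete n))) (ℕ⇒ℚ-* n (suc L))
         (ℕ⇒ℚ-mono-< (≤-<-trans (n[1+L]≤ sc) 2^<r′))
    where
    M₀ = proj₁ (2^<r k)
    bound = proj₂ (2^<r k)
    -- The successor makes M positive, as the division by M in `InRange⇒≤` demands.
    n₀ = proj₁ (scales (suc M₀))
    large = proj₂ (scales (suc M₀))

  vanishing : ∀ δ → UnitFraction ε → UnitFraction δ → ∃ λ n₁ → ∀ n → n₁ ≤ n → (3≤n : 3 ≤ n) → ∀ ℓ → 3 ≤ ℓ →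
    InRange ε n 3≤n ℓ → ratio ℓ n 3≤n <ᴿ δ
  vanishing δ (k , u , _ , uk≡1 , εu) (k′ , u′ , 0<u′ , u′k′≡1 , δu′) = n₁ , λ n n₁≤n 3≤n ℓ 3≤ℓ inRange →
    let L , M , sc , 2K≤M = large n n₁≤n
        kMℓ≤ = InRange⇒≤ sc 3≤n ε k {u} {ℓ} uk≡1 εu (≤-trans (s≤s z≤n) 2K≤M) inRange
        Mℓ≤ = *-cancelˡ-≤ (suc k) (≤-trans (≤-reflexive (sym (*-assoc (suc k) M ℓ)))
                (≤-trans kMℓ≤ (*-monoˡ-≤ (suc L) (n≤1+n k))))
    in u′ , ratio-upper sc 3≤n k′ 0<u′ u′k′≡1 2K≤M (≤-trans (s≤s z≤n) 3≤ℓ) Mℓ≤ , δu′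
    where
    -- The ratio is at most about ℓ / log n, hence about 1/M; M ≥ 2(k′+1) brings it down to 1/(k′+1)
    -- < δ with a factor of two for rounding.
    n₁ = proj₁ (scales (2 * suc k′))
    large = proj₂ (scales (2 * suc k′))
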